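{- Let $T=(V,\mathcal{E})$ be a tree rooted at $r$ with leaf set $L$, and let $E$ be a set of links on $V$ that is closed under shadows. Let $F$ be a shadows-minimal cover of $T$ by links of $E$ that has minimum size, and that among all minimum-size shadows-minimal covers has the maximum number of twin links. Let $W$ be the set of all twin links and locking links in $E$. Let $M$ be a maximum matching in the graph $(L,E(L,L)\setminus W)$, and let $U$ be the set of leaves unmatched by $M$. Let $M_F=F(L,L)\setminus W$, and let $N=\{bb'\in M: \text{neither } b \text{ nor } b' \text{ is matched by } M_F\}$. Let $J$ be the set of links of $F$ not incident to a locked leaf. Let $S$ be the set of stems and $X=V\setminus(L\cup S)$. Then $$\frac32|F|\ \ge\ \frac32|M|+|U|+\frac12|N|+\frac12\sum_{x\in X} d_J(x).$$
   Context: For nodes $u,v$, $P(uv)$ is the tree path between them; a link $uv$ covers the edges of $P(uv)$. A cover is a set of links covering all tree edges. A link $u'v'$ is a shadow of $uv$ if $P(u'v')\subseteq P(uv)$; it is a proper shadow if in addition $u'v'\ne uv$. $E$ is closed under shadows if every shadow of a link of $E$ is in $E$. An inclusion-minimal cover is shadows-minimal if replacing any of its links by any proper shadow of that link yields a non-cover. Leaves are the nodes other than $r$ with no descendants. $T_w$ denotes the rooted subtree of $w$ and its descendants. A link between leaves $a,b$ is a twin link (with $a,b$ twins) if contracting $P(ab)$ into a single node yields a new leaf; the least common ancestor of twins is a stem. The up-node of $a$ is the endpoint $u$ of a link $au\in E$ closest to $r$. A rooted subtree containing $a$ is $a$-closed if it contains the up-node of $a$. A leaf $a$ is locked by a link $bb'$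 (a locking link of $a$) if there is a rooted proper subtree $T_v$ with the following properties: its leaf set is $\{a,b,b'\}$, $ab$ is a twin link, and $T_v$ is $a$-closed. For vertex sets $A,B$, $F(A,B)$ is the set of links of $F$ with one endpoint in $A$ and the other in $B$ (similarly $E(L,L)$). $d_J(x)$ is the number of links of $J$ incident to $x$. -}

module Defs where

open import Data.Nat using (ℕ; zero; suc; _≤_; _<_; _<ᵇ_; _+_)
open import Data.Fin using (Fin; toℕ)
open import Data.Fin.Properties using (_≟_)
open import Data.Bool using (Bool; true; false; _∧_; _∨_; not; if_then_else_)
open import Data.List using (List; []; _∷_; map; concatMap; allFin)
open import Data.Nat.ListAction using (sum)
open import Data.Product using (Σ; ∃; ∃-syntax; _×_; _,_)
open import Data.Sum using (_⊎_)
open import Relation.Binary.PropositionalEquality using (_≡_; _≢_)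
open import Relation.Nullary using (¬_)
open import Relation.Nullary.Decidable using (⌊_⌋)
open import Function.Bundles using (_⇔_)

iter : ∀ {A : Set} → (A → A) → ℕ → A → A
iter f zero x = x
iter f (suc k) x = f (iter f k x)

count : ∀ {A : Set} → List A → (A → Bool) → ℕ
count [] p = 0
count (x ∷ xs) p = (if p x then 1 else 0) + count xs p

VertexSet : ℕ → Set
VertexSet n = Fin n → Bool

-- a link set is a Bool relation; it is required to be symmetric and
-- irreflexive (IsLinkSet) wherever it is meant as a set of links uv
LinkSet : ℕ → Set
LinkSet n = Fin n → Fin n → Bool

IsLinkSet : ∀ {n} → LinkSet n → Set
IsLinkSet {n} F = (∀ (u v : Fin n) → F u v ≡ F v u) × (∀ (u : Fin n) → F u u ≡ false)

pairs : ∀ n → List (Fin n × Fin n)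
pairs n = concatMap (λ u → map (λ v → (u , v)) (allFin n)) (allFin n)

size : ∀ {n} → LinkSet n → ℕ
size {n} F = count (pairs n) (λ { (u , v) → (toℕ u <ᵇ toℕ v) ∧ F u v })

card : ∀ {n} → VertexSet n → ℕ
card {n} A = count (allFin n) A

degree : ∀ {n} → LinkSet n → Fin n → ℕ
degree {n} J x = count (allFin n) (λ y → J x y)

sumOver : ∀ {n} → VertexSet n → (Fin n → ℕ) → ℕ
sumOver {n} X f = sum (map (λ x → if X x then f x else 0) (allFin n))

pairEqᵇ : ∀ {n} → Fin n → Fin n → Fin n → Fin n → Bool
pairEqᵇ x y u v = (⌊ x ≟ u ⌋ ∧ ⌊ y ≟ v ⌋) ∨ (⌊ x ≟ v ⌋ ∧ ⌊ y ≟ u ⌋)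

removeLink : ∀ {n} → LinkSet n → Fin n → Fin n → LinkSet n
removeLink F u v x y = F x y ∧ not (pairEqᵇ x y u v)

replaceLink : ∀ {n} → LinkSet n → Fin n → Fin n → Fin n → Fin n → LinkSet n
replaceLink F u v u' v' x y = removeLink F u v x y ∨ pairEqᵇ x y u' v'

SamePair : ∀ {n} → Fin n → Fin n → Fin n → Fin n → Set
SamePair u v x y = (u ≡ x × v ≡ y) ⊎ (u ≡ y × v ≡ x)

_⊆L_ : ∀ {n} → LinkSet n → LinkSet n → Set
F ⊆L E = ∀ u v → F u v ≡ true → E u v ≡ true

record RootedTree (n : ℕ) : Set where
  field
    root : Fin n
    parent : Fin n → Fin n
    parent-root : parent root ≡ root
    reaches-root : ∀ v → ∃[ k ] iter parent k v ≡ root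
open RootedTree public

module _ {n : ℕ} (T : RootedTree n) where

  -- u ∈T v  :  u is a node of the rooted subtree T_v
  _∈T_ : Fin n → Fin n → Set
  u ∈T v = ∃[ k ] iter (parent T) k u ≡ v

  Leaf : Fin n → Set
  Leaf v = v ≢ root T × (∀ w → parent T w ≢ v)

  -- the tree edge {c, parent c} (c ≠ r) lies on P(uv)
  OnPath : Fin n → Fin n → Fin n → Set
  OnPath u v c = c ≢ root T × ((u ∈T c × ¬ (v ∈T c)) ⊎ (¬ (u ∈T c) × v ∈T c))

  NodeOnPath : Fin n → Fin n → Fin n → Set
  NodeOnPath u v w = (u ∈T w ⊎ v ∈T w) × (∀ z → u ∈T z → v ∈T z → w ∈T z)

  IsLCA : Fin n → Fin n → Fin n → Set
  IsLCA u v l = u ∈T l × v ∈T l × (∀ z → u ∈T z → v ∈T z → l ∈T z)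

  Shadow : Fin n → Fin n → Fin n → Fin n → Set
  Shadow u' v' u v = ∀ c → OnPath u' v' c → OnPath u v c

  ProperShadow : Fin n → Fin n → Fin n → Fin n → Set
  ProperShadow u' v' u v = u' ≢ v' × Shadow u' v' u v × ¬ SamePair u' v' u v

  ClosedUnderShadows : LinkSet n → Set
  ClosedUnderShadows E =
    ∀ u v u' v' → E u v ≡ true → u' ≢ v' → Shadow u' v' u v → E u' v' ≡ true

  IsCover : LinkSet n → Set
  IsCover F = ∀ c → c ≢ root T → ∃[ u ] ∃[ v ] (F u v ≡ true × OnPath u v c)

  CoverBy : LinkSet n → LinkSet n → Set
  CoverBy E F = IsLinkSet F × F ⊆L E × IsCover F

  InclusionMinimalCover : LinkSet n → LinkSet n → Set
  InclusionMinimalCover E F =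
    CoverBy E F × (∀ u v → F u v ≡ true → ¬ IsCover (removeLink F u v))

  ShadowsMinimalCover : LinkSet n → LinkSet n → Set
  ShadowsMinimalCover E F =
    InclusionMinimalCover E F ×
    (∀ u v u' v' → F u v ≡ true → ProperShadow u' v' u v →
       ¬ IsCover (replaceLink F u v u' v'))

  -- ab is a twin link: a, b distinct leaves, and contracting P(ab) into
  -- one node gives a leaf (r not on the path, and no node off the path
  -- has its parent on the path)
  TwinLink : Fin n → Fin n → Set
  TwinLink a b =
    Leaf a × Leaf b × a ≢ b × ¬ NodeOnPath a b (root T) ×
    (∀ w → NodeOnPath a b (parent T w) → NodeOnPath a b w)

  Stem : Fin n → Set
  Stem s = ∃[ a ] ∃[ b ] (TwinLink a b × IsLCA a b s)

  HasTwinCount : LinkSet n → ℕ → Set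
  HasTwinCount F k =
    ∃[ tw ] ((∀ x y → (tw x y ≡ true) ⇔ (F x y ≡ true × TwinLink x y)) × size tw ≡ k)

  Depth : Fin n → ℕ → Set
  Depth v k = iter (parent T) k v ≡ root T × (∀ j → j < k → iter (parent T) j v ≢ root T)

  IsUpNode : LinkSet n → Fin n → Fin n → Set
  IsUpNode E a u =
    E a u ≡ true ×
    (∀ u' → E a u' ≡ true → ∀ k k' → Depth u k → Depth u' k' → k ≤ k')

  Closed : LinkSet n → Fin n → Fin n → Set
  Closed E a w = a ∈T w × ∃[ u ] (IsUpNode E a u × u ∈T w)

  LeafSetIs : Fin n → Fin n → Fin n → Fin n → Set
  LeafSetIs v a b b' = ∀ x → (x ∈T v × Leaf x) ⇔ (x ≡ a ⊎ x ≡ b ⊎ x ≡ b')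

  LockedBy : LinkSet n → Fin n → Fin n → Fin n → Set
  LockedBy E a b b' =
    a ≢ b' × b ≢ b' ×
    ∃[ v ] (v ≢ root T × LeafSetIs v a b b' × TwinLink a b × Closed E a v)

  LockingLink : LinkSet n → Fin n → Fin n → Set
  LockingLink E x y = ∃[ a ] (LockedBy E a x y ⊎ LockedBy E a y x)

  Locked : LinkSet n → Fin n → Set
  Locked E a = Leaf a × ∃[ b ] ∃[ b' ] LockedBy E a b b'

  InW : LinkSet n → Fin n → Fin n → Set
  InW E x y = E x y ≡ true × (TwinLink x y ⊎ LockingLink E x y)

  IsMatching : LinkSet n → LinkSet n → Set
  IsMatching E M =
    IsLinkSet M ×
    (∀ x y → M x y ≡ true → E x y ≡ true × Leaf x × Leaf y × ¬ InW E x y) ×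
    (∀ x y z → M x y ≡ true → M x z ≡ true → y ≡ z)

  MaximumMatching : LinkSet n → LinkSet n → Set
  MaximumMatching E M = IsMatching E M × (∀ M' → IsMatching E M' → size M' ≤ size M)

MatchedBy : ∀ {n} → LinkSet n → Fin n → Set
MatchedBy M x = ∃[ y ] M x y ≡ true

-- Every leaf has exactly one link in the shadows-minimal cover F, so 2|F| = |L| + Σ_{z ∉ L} d_F(z).
-- Counting leaves against M and against M_F gives |L| = 2|M| + |U| = 2|M_F| + |D|, where D is the
-- set of leaves unmatched by M_F, and M_F ∪ N is again a matching of (L, E(L,L) \ W), so
-- |M_F| + |N| ≤ |M|.  What remains is |D| ≤ Σ_z charge(z) with, for every node z,
-- charge(z) + 2[z ∈ X] d_J(z) ≤ 3 [z ∉ L] d_F(z).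
--
-- A leaf x ∈ D is charged to its partner if that is an inner node, to the stem of its link if that
-- is a twin link, and otherwise (the link then lies in W, so it locks some leaf a) to the partner
-- of a, an inner node of the a-closed subtree whose link to a is not in J.  An inner node z receives
-- at most d_F(z) charges of the first kind; at most two of the second kind, and then none of the
-- third and z is a stem incident to F; and at most two of the third kind per link of F \ J at z.

module Submission where

open import Defs
open import Data.Nat using (ℕ; zero; suc; _≤_; _<_; _≥_; _+_; _*_; _∸_; z≤n; s≤s; s≤s⁻¹; _<ᵇ_; _≤?_; >-nonZero)
open import Data.Nat.Properties hiding (_≟_)
import Data.Nat.ListAction as ListAction
open import Data.Bool using (Bool; true; false; _∧_; _∨_; not; if_then_else_)
open import Data.Bool.Properties using (∨-zeroʳ; ∧-zeroʳ; ∧-identityʳ; ¬-not)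
import Data.Bool as Bool
open import Data.Fin using (Fin; toℕ; fromℕ; fromℕ<)
import Data.Fin as Fin
open import Data.Fin.Properties using (_≟_; any?; all?; toℕ-injective; toℕ-fromℕ; toℕ-fromℕ<)
import Data.Fin.Properties as Finₚ
open import Data.List using (List; []; _∷_; _++_; map; tabulate; concatMap; allFin)
open import Data.Product using (∃-syntax; _×_; _,_; proj₁; proj₂)
open import Data.Sum using (_⊎_; inj₁; inj₂)
import Data.Sum
open import Data.Empty using (⊥; ⊥-elim)
open import Function using (_∘_; id)
open import Relation.Binary.PropositionalEquality using (_≡_; _≢_; refl; sym; trans; cong; cong₂; subst; module ≡-Reasoning)
open import Relation.Nullary using (¬_; Dec; yes; no; does; _×-dec_; _⊎-dec_; _→-dec_; ¬?)
open import Relation.Nullary.Decidable using (⌊_⌋; dec-true; dec-false; map′)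
open import Function.Bundles using (_⇔_; Equivalence; mk⇔)
open import Data.Nat.Tactic.RingSolver using (solve-∀)
open import Algebra.Properties.Semiring.Sum +-*-semiring
  using (sum-syntax; sum-cong-≗; sum-replicate-zero; ∑-distrib-+; ∑-comm; *-distribˡ-sum; *-distribʳ-sum)

open Equivalence using (to; from)

indicator : Bool → ℕ
indicator b = if b then 1 else 0

does-true : ∀ {A : Set} (a? : Dec A) → does a? ≡ true → A
does-true (yes a) _ = a

≡true-⇔⇒≡ : ∀ {a b} → (a ≡ true ⇔ b ≡ true) → a ≡ b
≡true-⇔⇒≡ {true} a⇔b = sym (to a⇔b refl)
≡true-⇔⇒≡ {false} {false} a⇔b = refl
≡true-⇔⇒≡ {false} {true} a⇔b = from a⇔b refl

module _ {A : Set} where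

  count-++ : (xs ys : List A) (p : A → Bool) → count (xs ++ ys) p ≡ count xs p + count ys p
  count-++ [] ys p = refl
  count-++ (x ∷ xs) ys p = trans (cong (indicator (p x) +_) (count-++ xs ys p)) (sym (+-assoc (indicator (p x)) _ _))

  count-tabulate : ∀ {n} (h : Fin n → A) (p : A → Bool) → count (tabulate h) p ≡ ∑[ i < n ] indicator (p (h i))
  count-tabulate {zero} h p = refl
  count-tabulate {suc n} h p = cong (indicator (p (h Fin.zero)) +_) (count-tabulate (h ∘ Fin.suc) p)

  count-concatMap : {B : Set} (f : B → List A) (xs : List B) (p : A → Bool) →
                    count (concatMap f xs) p ≡ ListAction.sum (map (λ x → count (f x) p) xs)
  count-concatMap f [] p = refl
  count-concatMap f (x ∷ xs) p = trans (count-++ (f x) (concatMap f xs) p) (cong (count (f x) p +_) (count-concatMap f xs p))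

  count-map : {B : Set} (f : B → A) (xs : List B) (p : A → Bool) → count (map f xs) p ≡ count xs (p ∘ f)
  count-map f [] p = refl
  count-map f (x ∷ xs) p = cong (indicator (p (f x)) +_) (count-map f xs p)

sum-map-tabulate : ∀ {A : Set} {n} (h : Fin n → A) (g : A → ℕ) → ListAction.sum (map g (tabulate h)) ≡ ∑[ i < n ] g (h i)
sum-map-tabulate {n = zero} h g = refl
sum-map-tabulate {n = suc n} h g = cong (g (h Fin.zero) +_) (sum-map-tabulate (h ∘ Fin.suc) g)

∑-mono-≤ : ∀ {n} {f g : Fin n → ℕ} → (∀ i → f i ≤ g i) → ∑[ i < n ] f i ≤ ∑[ i < n ] g i
∑-mono-≤ {zero} f≤g = z≤n
∑-mono-≤ {suc n} f≤g = +-mono-≤ (f≤g Fin.zero) (∑-mono-≤ (f≤g ∘ Fin.suc))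

module _ {n : ℕ} where

  card≡∑ : (p : Fin n → Bool) → card p ≡ ∑[ i < n ] indicator (p i)
  card≡∑ = count-tabulate id

  sumOver≡∑ : (X : VertexSet n) (f : Fin n → ℕ) → sumOver X f ≡ ∑[ i < n ] (if X i then f i else 0)
  sumOver≡∑ X f = sum-map-tabulate id (λ i → if X i then f i else 0)

  degree≡∑ : (G : LinkSet n) (u : Fin n) → degree G u ≡ ∑[ v < n ] indicator (G u v)
  degree≡∑ G u = card≡∑ (G u)

  size≡∑∑ : (G : LinkSet n) → size G ≡ ∑[ u < n ] ∑[ v < n ] indicator ((toℕ u <ᵇ toℕ v) ∧ G u v)
  size≡∑∑ G = begin
    size G                                                      ≡⟨⟩
    count (concatMap row (allFin n)) link                       ≡⟨ count-concatMap row (allFin n) link ⟩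
    ListAction.sum (map (λ u → count (row u) link) (allFin n))  ≡⟨ sum-map-tabulate id (λ u → count (row u) link) ⟩
    ∑[ u < n ] count (row u) link                               ≡⟨ sum-cong-≗ (λ u → count-map (u ,_) (allFin n) link) ⟩
    ∑[ u < n ] card (λ v → link (u , v))                        ≡⟨ sum-cong-≗ (λ u → card≡∑ (λ v → link (u , v))) ⟩
    ∑[ u < n ] ∑[ v < n ] indicator (link (u , v))              ∎
    where
    open ≡-Reasoning
    link : Fin n × Fin n → Bool
    link (u , v) = (toℕ u <ᵇ toℕ v) ∧ G u v
    row : Fin n → List (Fin n × Fin n)
    row u = map (u ,_) (allFin n)

  card-cong : {p q : Fin n → Bool} → (∀ i → p i ≡ q i) → card p ≡ card q
  card-cong {p} {q} p≗q = begin
    card p                            ≡⟨ card≡∑ p ⟩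
    ∑[ i < n ] indicator (p i)        ≡⟨ sum-cong-≗ (cong indicator ∘ p≗q) ⟩
    ∑[ i < n ] indicator (q i)        ≡⟨ card≡∑ q ⟨
    card q                            ∎
    where open ≡-Reasoning

  card-mono : {p q : Fin n → Bool} → (∀ i → p i ≡ true → q i ≡ true) → card p ≤ card q
  card-mono {p} {q} p⊆q = begin
    card p                      ≡⟨ card≡∑ p ⟩
    ∑[ i < n ] indicator (p i)  ≤⟨ ∑-mono-≤ (λ i → indicator-mono (p i) (q i) (p⊆q i)) ⟩
    ∑[ i < n ] indicator (q i)  ≡⟨ card≡∑ q ⟨
    card q                      ∎
    where
    open ≤-Reasoning
    indicator-mono : ∀ a b → (a ≡ true → b ≡ true) → indicator a ≤ indicator b
    indicator-mono false b _ = z≤n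
    indicator-mono true b a⇒b rewrite a⇒b refl = ≤-refl

  card-∨ : (p q : Fin n → Bool) → card (λ i → p i ∨ q i) ≤ card p + card q
  card-∨ p q = begin
    card (λ i → p i ∨ q i)                                   ≡⟨ card≡∑ _ ⟩
    ∑[ i < n ] indicator (p i ∨ q i)                         ≤⟨ ∑-mono-≤ (λ i → indicator-∨ (p i) (q i)) ⟩
    ∑[ i < n ] (indicator (p i) + indicator (q i))           ≡⟨ ∑-distrib-+ (indicator ∘ p) (indicator ∘ q) ⟩
    ∑[ i < n ] indicator (p i) + ∑[ i < n ] indicator (q i)  ≡⟨ cong₂ _+_ (card≡∑ p) (card≡∑ q) ⟨
    card p + card q                                          ∎
    where
    open ≤-Reasoning
    indicator-∨ : ∀ a b → indicator (a ∨ b) ≤ indicator a + indicator b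
    indicator-∨ true b = s≤s z≤n
    indicator-∨ false b = ≤-refl

  card-split : (p q : Fin n → Bool) → card p ≡ card (λ i → p i ∧ q i) + card (λ i → p i ∧ not (q i))
  card-split p q = begin
    card p
      ≡⟨ card≡∑ p ⟩
    ∑[ i < n ] indicator (p i)
      ≡⟨ sum-cong-≗ (λ i → indicator-split (p i) (q i)) ⟩
    ∑[ i < n ] (indicator (p∧q i) + indicator (p∧¬q i))
      ≡⟨ ∑-distrib-+ (indicator ∘ p∧q) (indicator ∘ p∧¬q) ⟩
    ∑[ i < n ] indicator (p∧q i) + ∑[ i < n ] indicator (p∧¬q i)
      ≡⟨ cong₂ _+_ (card≡∑ p∧q) (card≡∑ p∧¬q) ⟨
    card p∧q + card p∧¬q ∎
    where
    open ≡-Reasoning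
    p∧q p∧¬q : Fin n → Bool
    p∧q i = p i ∧ q i
    p∧¬q i = p i ∧ not (q i)
    indicator-split : ∀ a b → indicator a ≡ indicator (a ∧ b) + indicator (a ∧ not b)
    indicator-split false b = refl
    indicator-split true true = refl
    indicator-split true false = refl

  card-zero : {p : Fin n → Bool} → (∀ i → p i ≡ false) → card p ≡ 0
  card-zero {p} p≗false = trans (card-cong p≗false) (trans (card≡∑ _) (sum-replicate-zero n))

  card-pos : (p : Fin n → Bool) {i : Fin n} → p i ≡ true → 1 ≤ card p
  card-pos p {i} pi = begin
    1                           ≡⟨ cong indicator pi ⟨
    indicator (p i)             ≤⟨ term≤∑ i ⟩
    ∑[ j < n ] indicator (p j)  ≡⟨ card≡∑ p ⟨
    card p                      ∎
    where
    open ≤-Reasoning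
    term≤∑ : ∀ {m} {f : Fin m → ℕ} i → f i ≤ ∑[ j < m ] f j
    term≤∑ Fin.zero = m≤m+n _ _
    term≤∑ {f = f} (Fin.suc i) = ≤-trans (term≤∑ i) (m≤n+m _ (f Fin.zero))

∑-indicator≤1 : ∀ {n} (p : Fin n → Bool) → (∀ i j → p i ≡ true → p j ≡ true → i ≡ j) →
                ∑[ i < n ] indicator (p i) ≤ 1
∑-indicator≤1 {zero} p _ = z≤n
∑-indicator≤1 {suc n} p unique with p Fin.zero in p0
... | true = ≤-reflexive (cong suc (trans (sym (card≡∑ (p ∘ Fin.suc))) (card-zero rest-false)))
  where
  rest-false : ∀ i → p (Fin.suc i) ≡ false
  rest-false i = ¬-not (λ pi → Finₚ.0≢1+n (unique _ _ p0 pi))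
... | false = ∑-indicator≤1 (p ∘ Fin.suc) (λ i j pi pj → Finₚ.suc-injective (unique _ _ pi pj))

module _ {n : ℕ} where

  card-≤1 : {p : Fin n → Bool} → (∀ i j → p i ≡ true → p j ≡ true → i ≡ j) → card p ≤ 1
  card-≤1 {p} unique = subst (_≤ 1) (sym (card≡∑ p)) (∑-indicator≤1 p unique)

  card-≡1 : {p : Fin n → Bool} {i : Fin n} → p i ≡ true → (∀ j → p j ≡ true → j ≡ i) → card p ≡ 1
  card-≡1 {p} pi only-i = ≤-antisym (card-≤1 (λ j k pj pk → trans (only-i j pj) (sym (only-i k pk)))) (card-pos p pi)

  card-≤2 : {p : Fin n → Bool} (e₁ e₂ : Fin n) → (∀ i → p i ≡ true → i ≡ e₁ ⊎ i ≡ e₂) → card p ≤ 2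
  card-≤2 {p} e₁ e₂ p⊆ = begin
    card p                          ≤⟨ card-mono within ⟩
    card (λ i → is e₁ i ∨ is e₂ i)  ≤⟨ card-∨ (is e₁) (is e₂) ⟩
    card (is e₁) + card (is e₂)     ≤⟨ +-mono-≤ (card-≤1 (single e₁)) (card-≤1 (single e₂)) ⟩
    2                               ∎
    where
    open ≤-Reasoning
    is : Fin n → Fin n → Bool
    is e i = does (i ≟ e)
    single : ∀ e i j → is e i ≡ true → is e j ≡ true → i ≡ j
    single e i j ie je = trans (does-true (i ≟ e) ie) (sym (does-true (j ≟ e) je))
    within : ∀ i → p i ≡ true → (is e₁ i ∨ is e₂ i) ≡ true
    within i pi with p⊆ i pi
    ... | inj₁ refl rewrite dec-true (e₁ ≟ e₁) refl = refl
    ... | inj₂ refl rewrite dec-true (e₂ ≟ e₂) refl = ∨-zeroʳ (is e₁ e₂)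

  card-any≤∑card : {R : Fin n → Fin n → Set} (R? : ∀ x z → Dec (R x z)) →
                   card (λ x → does (any? (R? x))) ≤ ∑[ z < n ] card (λ x → does (R? x z))
  card-any≤∑card R? = begin
    card (λ x → does (any? (R? x)))                  ≡⟨ card≡∑ (λ x → does (any? (R? x))) ⟩
    ∑[ x < n ] indicator (does (any? (R? x)))        ≤⟨ ∑-mono-≤ witness≤card ⟩
    ∑[ x < n ] card (λ z → does (R? x z))            ≡⟨ sum-cong-≗ (λ x → card≡∑ (does ∘ R? x)) ⟩
    ∑[ x < n ] ∑[ z < n ] indicator (does (R? x z))  ≡⟨ ∑-comm (λ x z → indicator (does (R? x z))) ⟩
    ∑[ z < n ] ∑[ x < n ] indicator (does (R? x z))  ≡⟨ sum-cong-≗ (λ z → card≡∑ (λ x → does (R? x z))) ⟨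
    ∑[ z < n ] card (λ x → does (R? x z))            ∎
    where
    open ≤-Reasoning
    witness≤card : ∀ x → indicator (does (any? (R? x))) ≤ card (λ z → does (R? x z))
    witness≤card x with any? (R? x)
    ... | yes (z , r) = card-pos (does ∘ R? x) (dec-true (R? x z) r)
    ... | no _ = z≤n

  card-any×≤ : {Q : Fin n → Set} {S : Fin n → Fin n → Set} (Q? : ∀ a → Dec (Q a)) (S? : ∀ a x → Dec (S a x))
               (k : ℕ) → (∀ a → card (λ x → does (S? a x)) ≤ k) →
               card (λ x → does (any? (λ a → Q? a ×-dec S? a x))) ≤ card (λ a → does (Q? a)) * k
  card-any×≤ Q? S? k fibre≤k = begin
    card (λ x → does (any? (λ a → Q? a ×-dec S? a x)))    ≤⟨ card-any≤∑card (λ x a → Q? a ×-dec S? a x) ⟩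
    ∑[ a < n ] card (λ x → does (Q? a) ∧ does (S? a x))   ≤⟨ ∑-mono-≤ fibre≤ ⟩
    ∑[ a < n ] (indicator (does (Q? a)) * k)              ≡⟨ *-distribʳ-sum k (λ a → indicator (does (Q? a))) ⟨
    (∑[ a < n ] indicator (does (Q? a))) * k              ≡⟨ cong (_* k) (card≡∑ (does ∘ Q?)) ⟨
    card (λ a → does (Q? a)) * k                          ∎
    where
    open ≤-Reasoning
    fibre≤ : ∀ a → card (λ x → does (Q? a) ∧ does (S? a x)) ≤ indicator (does (Q? a)) * k
    fibre≤ a with does (Q? a)
    ... | true = ≤-trans (fibre≤k a) (≤-reflexive (sym (+-identityʳ k)))
    ... | false = ≤-reflexive (card-zero {n} (λ _ → refl))

<ᵇ-flip : ∀ a b → a ≢ b → not (a <ᵇ b) ≡ (b <ᵇ a)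
<ᵇ-flip zero zero a≢b = ⊥-elim (a≢b refl)
<ᵇ-flip zero (suc b) _ = refl
<ᵇ-flip (suc a) zero _ = refl
<ᵇ-flip (suc a) (suc b) a≢b = <ᵇ-flip a b (a≢b ∘ cong suc)

module _ {n : ℕ} where

  private
    below : LinkSet n → Fin n → Fin n → ℕ
    below G u v = indicator ((toℕ u <ᵇ toℕ v) ∧ G u v)

  handshake : (G : LinkSet n) → IsLinkSet G → 2 * size G ≡ ∑[ u < n ] degree G u
  handshake G (G-sym , G-irrefl) = sym (begin
    ∑[ u < n ] degree G u
      ≡⟨ sum-cong-≗ (degree≡∑ G) ⟩
    ∑[ u < n ] ∑[ v < n ] indicator (G u v)
      ≡⟨ sum-cong-≗ (λ u → sum-cong-≗ (split u)) ⟩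
    ∑[ u < n ] ∑[ v < n ] (below G u v + below G v u)
      ≡⟨ sum-cong-≗ (λ u → ∑-distrib-+ (below G u) (λ v → below G v u)) ⟩
    ∑[ u < n ] (∑[ v < n ] below G u v + ∑[ v < n ] below G v u)
      ≡⟨ ∑-distrib-+ (λ u → ∑[ v < n ] below G u v) (λ u → ∑[ v < n ] below G v u) ⟩
    ∑[ u < n ] ∑[ v < n ] below G u v + ∑[ u < n ] ∑[ v < n ] below G v u
      ≡⟨ cong (∑[ u < n ] ∑[ v < n ] below G u v +_) (∑-comm (λ u v → below G v u)) ⟩
    ∑[ u < n ] ∑[ v < n ] below G u v + ∑[ v < n ] ∑[ u < n ] below G v u
      ≡⟨ cong₂ _+_ (size≡∑∑ G) (size≡∑∑ G) ⟨
    size G + size G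
      ≡⟨ cong (size G +_) (+-identityʳ (size G)) ⟨
    2 * size G ∎)
    where
    open ≡-Reasoning
    by-order : ∀ l g → indicator g ≡ indicator (l ∧ g) + indicator (not l ∧ g)
    by-order true g = sym (+-identityʳ (indicator g))
    by-order false g = refl
    split : ∀ u v → indicator (G u v) ≡ below G u v + below G v u
    split u v with u ≟ v
    ... | yes refl rewrite G-irrefl u | ∧-zeroʳ (toℕ u <ᵇ toℕ u) = refl
    ... | no u≢v rewrite G-sym v u | sym (<ᵇ-flip (toℕ u) (toℕ v) (u≢v ∘ toℕ-injective)) =
      by-order (toℕ u <ᵇ toℕ v) (G u v)

  size-∨ : (G H : LinkSet n) → (∀ x y → G x y ≡ true → H x y ≡ true → ⊥) →
           size (λ x y → G x y ∨ H x y) ≡ size G + size H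
  size-∨ G H disjoint = begin
    size (λ x y → G x y ∨ H x y)
      ≡⟨ size≡∑∑ (λ x y → G x y ∨ H x y) ⟩
    ∑[ u < n ] ∑[ v < n ] below (λ x y → G x y ∨ H x y) u v
      ≡⟨ sum-cong-≗ (λ u → sum-cong-≗ (λ v → split (toℕ u <ᵇ toℕ v) (disjoint u v))) ⟩
    ∑[ u < n ] ∑[ v < n ] (below G u v + below H u v)
      ≡⟨ sum-cong-≗ (λ u → ∑-distrib-+ (below G u) (below H u)) ⟩
    ∑[ u < n ] (∑[ v < n ] below G u v + ∑[ v < n ] below H u v)
      ≡⟨ ∑-distrib-+ (λ u → ∑[ v < n ] below G u v) (λ u → ∑[ v < n ] below H u v) ⟩
    ∑[ u < n ] ∑[ v < n ] below G u v + ∑[ u < n ] ∑[ v < n ] below H u v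
      ≡⟨ cong₂ _+_ (size≡∑∑ G) (size≡∑∑ H) ⟨
    size G + size H ∎
    where
    open ≡-Reasoning
    split : ∀ l {g h} → (g ≡ true → h ≡ true → ⊥) →
            indicator (l ∧ (g ∨ h)) ≡ indicator (l ∧ g) + indicator (l ∧ h)
    split false _ = refl
    split true {true} {true} g∧h = ⊥-elim (g∧h refl refl)
    split true {true} {false} _ = refl
    split true {false} _ = refl

  matched? : (G : LinkSet n) (x : Fin n) → Dec (MatchedBy G x)
  matched? G x = any? (λ y → G x y Bool.≟ true)

  card≡2*size+unmatched : (G : LinkSet n) (A : VertexSet n) → IsLinkSet G →
    (∀ x y → G x y ≡ true → A x ≡ true) → (∀ x y z → G x y ≡ true → G x z ≡ true → y ≡ z) →
    card A ≡ 2 * size G + card (λ x → A x ∧ not (does (matched? G x)))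
  card≡2*size+unmatched G A G-linkSet G⊆A G-matching = begin
    card A
      ≡⟨ card≡∑ A ⟩
    ∑[ x < n ] indicator (A x)
      ≡⟨ sum-cong-≗ per-vertex ⟩
    ∑[ x < n ] (degree G x + indicator (unmatched x))
      ≡⟨ ∑-distrib-+ (degree G) (indicator ∘ unmatched) ⟩
    ∑[ x < n ] degree G x + ∑[ x < n ] indicator (unmatched x)
      ≡⟨ cong₂ _+_ (handshake G G-linkSet) (card≡∑ unmatched) ⟨
    2 * size G + card unmatched ∎
    where
    open ≡-Reasoning
    unmatched : Fin n → Bool
    unmatched x = A x ∧ not (does (matched? G x))
    per-vertex : ∀ x → indicator (A x) ≡ degree G x + indicator (unmatched x)
    per-vertex x with matched? G x
    ... | yes (y , Gxy) rewrite G⊆A x y Gxy =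
      sym (trans (+-identityʳ (degree G x)) (card-≡1 {n} Gxy (λ z Gxz → G-matching x z y Gxz Gxy)))
    ... | no unmatched rewrite ∧-identityʳ (A x) =
      sym (cong (_+ indicator (A x)) (card-zero {n} (λ y → ¬-not (λ Gxy → unmatched (y , Gxy)))))

module _ {A : Set} (f : A → A) where

  iter-+ : ∀ i j x → iter f (i + j) x ≡ iter f i (iter f j x)
  iter-+ zero j x = refl
  iter-+ (suc i) j x = cong f (iter-+ i j x)

  iter-suc : ∀ k x → iter f (suc k) x ≡ iter f k (f x)
  iter-suc k x = trans (cong (λ i → iter f i x) (+-comm 1 k)) (iter-+ k 1 x)

  iter-fixed : ∀ {x} → f x ≡ x → ∀ k → iter f k x ≡ x
  iter-fixed fx≡x zero = refl
  iter-fixed fx≡x (suc k) = trans (cong f (iter-fixed fx≡x k)) fx≡x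

  iter-∸+ : ∀ {i j} x → j ≤ i → iter f i x ≡ iter f (i ∸ j) (iter f j x)
  iter-∸+ {i} {j} x j≤i = trans (cong (λ k → iter f k x) (sym (m∸n+n≡m j≤i))) (iter-+ (i ∸ j) j x)

  iter-periodic : ∀ {p x} → iter f p x ≡ x → ∀ t → iter f (t * p) x ≡ x
  iter-periodic fᵖx≡x zero = refl
  iter-periodic {p} {x} fᵖx≡x (suc t) = trans (iter-+ p (t * p) x) (trans (cong (iter f p) (iter-periodic fᵖx≡x t)) fᵖx≡x)

least-witness : {P : ℕ → Set} → (∀ k → Dec (P k)) → ∀ {m} → P m → ∃[ k ] (P k × (∀ j → j < k → ¬ P j))
least-witness P? {zero} P0 = 0 , P0 , λ _ ()
least-witness P? {suc m} Psm with P? 0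
... | yes P0 = 0 , P0 , λ _ ()
... | no ¬P0 with least-witness (P? ∘ suc) Psm
... | k , Pk , below-k = suc k , Pk , λ { zero _ → ¬P0 ; (suc j) j<k → below-k j (s≤s⁻¹ j<k) }

module TreeOrder {n : ℕ} (T : RootedTree n) where

  infix 4 _⊑_ _⊑?_

  _⊑_ : Fin n → Fin n → Set
  u ⊑ v = _∈T_ T u v

  ↑ : ℕ → Fin n → Fin n
  ↑ = iter (parent T)

  ⊑-refl : ∀ {u} → u ⊑ u
  ⊑-refl = 0 , refl

  ⊑-trans : ∀ {u v w} → u ⊑ v → v ⊑ w → u ⊑ w
  ⊑-trans {u} (i , uᵢ≡v) (j , vⱼ≡w) = j + i , trans (iter-+ (parent T) j i u) (trans (cong (↑ j) uᵢ≡v) vⱼ≡w)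

  ⊑-parent : ∀ u → u ⊑ parent T u
  ⊑-parent u = 1 , refl

  parent-⊑ : ∀ {u c} → u ⊑ c → u ≢ c → parent T u ⊑ c
  parent-⊑ (zero , u≡c) u≢c = ⊥-elim (u≢c u≡c)
  parent-⊑ {u} (suc k , uₖ₊₁≡c) _ = k , trans (sym (iter-suc (parent T) k u)) uₖ₊₁≡c

  ⊑-leaf : ∀ {u a} → Leaf T a → u ⊑ a → u ≡ a
  ⊑-leaf leaf (zero , u≡a) = u≡a
  ⊑-leaf {u} leaf (suc k , uₖ₊₁≡a) = ⊥-elim (proj₂ leaf (↑ k u) uₖ₊₁≡a)

  root-absorbs : ∀ {k m x} → ↑ k x ≡ root T → k ≤ m → ↑ m x ≡ root T
  root-absorbs {k} {m} {x} xₖ≡r k≤m =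
    trans (iter-∸+ (parent T) x k≤m) (trans (cong (↑ (m ∸ k)) xₖ≡r) (iter-fixed (parent T) (parent-root T) (m ∸ k)))

  ⊑-climb : ∀ {a c d i j} → i ≤ j → ↑ i a ≡ c → ↑ j a ≡ d → c ⊑ d
  ⊑-climb {a} {i = i} {j} i≤j aᵢ≡c aⱼ≡d =
    j ∸ i , trans (cong (↑ (j ∸ i)) (sym aᵢ≡c)) (trans (sym (iter-∸+ (parent T) a i≤j)) aⱼ≡d)

  ancestors-comparable : ∀ {a c d} → a ⊑ c → a ⊑ d → c ⊑ d ⊎ d ⊑ c
  ancestors-comparable (i , aᵢ≡c) (j , aⱼ≡d) with ≤-total i j
  ... | inj₁ i≤j = inj₁ (⊑-climb i≤j aᵢ≡c aⱼ≡d)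
  ... | inj₂ j≤i = inj₂ (⊑-climb j≤i aⱼ≡d aᵢ≡c)

  ancestor-above : ∀ {u v l c} → u ⊑ l → ¬ v ⊑ l → u ⊑ c → v ⊑ c → l ⊑ c
  ancestor-above u⊑l v⋢l u⊑c v⊑c with ancestors-comparable u⊑c u⊑l
  ... | inj₁ c⊑l = ⊥-elim (v⋢l (⊑-trans v⊑c c⊑l))
  ... | inj₂ l⊑c = l⊑c

  cycle⇒root : ∀ {k c} → 0 < k → ↑ k c ≡ c → c ≡ root T
  cycle⇒root {k} {c} 0<k cycle with reaches-root T c
  ... | K , cₖ≡r = trans (sym (iter-periodic (parent T) cycle K)) (root-absorbs cₖ≡r (m≤m*n K k {{>-nonZero 0<k}}))

  ⊑-antisym : ∀ {c d} → c ⊑ d → d ⊑ c → c ≡ d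
  ⊑-antisym (zero , c≡d) _ = c≡d
  ⊑-antisym {c} {d} c⊑d@(suc i , cᵢ₊₁≡d) d⊑c@(j , _) = trans c≡r (sym d≡r)
    where
    c≡r : c ≡ root T
    c≡r = cycle⇒root (subst (0 <_) (sym (+-suc j i)) (s≤s z≤n)) (proj₂ (⊑-trans c⊑d d⊑c))
    d≡r : d ≡ root T
    d≡r = trans (sym cᵢ₊₁≡d) (trans (cong (↑ (suc i)) c≡r) (iter-fixed (parent T) (parent-root T) (suc i)))

  parent-⋢ : ∀ {v} → v ≢ root T → ¬ (parent T v ⊑ v)
  parent-⋢ {v} v≢r pv⊑v = v≢r (cycle⇒root {1} (s≤s z≤n) (⊑-antisym pv⊑v (⊑-parent v)))

  -- The decision procedures are opaque, so that `with` abstracts them instead of normalising them.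
  opaque
    _⊑?_ : ∀ u v → Dec (u ⊑ v)
    u ⊑? v with reaches-root T u
    ... | K , uₖ≡r =
      map′ (λ (i , uᵢ≡v) → toℕ i , uᵢ≡v) bounded (any? (λ (i : Fin (suc K)) → ↑ (toℕ i) u ≟ v))
      where
      -- u reaches the root after K steps, so its first K + 1 ancestors are all of them.
      bounded : u ⊑ v → ∃[ i ] ↑ (toℕ {suc K} i) u ≡ v
      bounded (k , uₖ≡v) with k ≤? K
      ... | yes k≤K = fromℕ< (s≤s k≤K) , trans (cong (λ j → ↑ j u) (toℕ-fromℕ< (s≤s k≤K))) uₖ≡v
      ... | no k≰K = fromℕ K , trans (cong (λ j → ↑ j u) (toℕ-fromℕ K)) (trans uₖ≡r (sym v≡r))
        where
        v≡r : v ≡ root T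
        v≡r = trans (sym uₖ≡v) (root-absorbs uₖ≡r (<⇒≤ (≰⇒> k≰K)))

  depth-exists : ∀ v → ∃[ k ] Depth T v k
  depth-exists v with reaches-root T v
  ... | K , vₖ≡r = least-witness (λ k → ↑ k v ≟ root T) {K} vₖ≡r

  depth-minimal : ∀ {v k j} → Depth T v k → ↑ j v ≡ root T → k ≤ j
  depth-minimal (_ , below-k) vⱼ≡r = ≮⇒≥ (λ j<k → below-k _ j<k vⱼ≡r)

  depth-parent< : ∀ {u v k k′} → u ⊑ v → v ≢ root T → Depth T u k → Depth T (parent T v) k′ → k′ < k
  depth-parent< {u} {v} {k} {k′} (m , uₘ≡v) v≢r (uₖ≡r , _) depth-pv = begin-strict
    k′           ≤⟨ depth-minimal depth-pv pv-reaches-root ⟩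
    k ∸ suc m    <⟨ ∸-monoʳ-< {o = 0} (s≤s z≤n) m<k ⟩
    k            ∎
    where
    open ≤-Reasoning
    m<k : m < k
    m<k = ≰⇒> (λ k≤m → v≢r (trans (sym uₘ≡v) (root-absorbs uₖ≡r k≤m)))
    pv-reaches-root : ↑ (k ∸ suc m) (parent T v) ≡ root T
    pv-reaches-root = trans (cong (↑ (k ∸ suc m) ∘ parent T) (sym uₘ≡v)) (trans (sym (iter-∸+ (parent T) u m<k)) uₖ≡r)

  lca-exists : ∀ u v → ∃[ l ] IsLCA T u v l
  lca-exists u v with reaches-root T u
  ... | K , uₖ≡r with least-witness (λ k → v ⊑? ↑ k u) {K} (subst (v ⊑_) (sym uₖ≡r) (reaches-root T v))
  ... | k , v⊑uₖ , below-k = ↑ k u , (k , refl) , v⊑uₖ , least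
    where
    least : ∀ z → u ⊑ z → v ⊑ z → ↑ k u ⊑ z
    least z (j , uⱼ≡z) v⊑z with k ≤? j
    ... | yes k≤j = ⊑-climb k≤j refl uⱼ≡z
    ... | no k≰j = ⊥-elim (below-k j (≰⇒> k≰j) (subst (v ⊑_) (sym uⱼ≡z) v⊑z))

  OnPath-sym : ∀ {u v c} → OnPath T u v c → OnPath T v u c
  OnPath-sym (c≢r , inj₁ (u⊑c , v⋢c)) = c≢r , inj₂ (v⋢c , u⊑c)
  OnPath-sym (c≢r , inj₂ (u⋢c , v⊑c)) = c≢r , inj₁ (v⊑c , u⋢c)

  SamePair-OnPath : ∀ {x y u v c} → SamePair x y u v → OnPath T x y c → OnPath T u v c
  SamePair-OnPath (inj₁ (refl , refl)) onPath = onPath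
  SamePair-OnPath (inj₂ (refl , refl)) onPath = OnPath-sym onPath

  ¬OnPath-loop : ∀ {u c} → ¬ OnPath T u u c
  ¬OnPath-loop (_ , inj₁ (u⊑c , u⋢c)) = u⋢c u⊑c
  ¬OnPath-loop (_ , inj₂ (u⋢c , u⊑c)) = u⋢c u⊑c

  OnPath-parent : ∀ {u v c} → OnPath T u v c → c ≡ u ⊎ OnPath T (parent T u) v c
  OnPath-parent {u} {v} {c} (c≢r , inj₁ (u⊑c , v⋢c)) with u ≟ c
  ... | yes u≡c = inj₁ (sym u≡c)
  ... | no u≢c = inj₂ (c≢r , inj₁ (parent-⊑ u⊑c u≢c , v⋢c))
  OnPath-parent {u} (c≢r , inj₂ (u⋢c , v⊑c)) = inj₂ (c≢r , inj₂ (u⋢c ∘ ⊑-trans (⊑-parent u) , v⊑c))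

  shadow-lift : ∀ {u v l} → u ⊑ l → (∀ c → u ⊑ c → v ⊑ c → l ⊑ c) → Shadow T l v u v
  shadow-lift u⊑l l-below c (c≢r , inj₁ (l⊑c , v⋢c)) = c≢r , inj₁ (⊑-trans u⊑l l⊑c , v⋢c)
  shadow-lift u⊑l l-below c (c≢r , inj₂ (l⋢c , v⊑c)) = c≢r , inj₂ ((λ u⊑c → l⋢c (l-below c u⊑c v⊑c)) , v⊑c)

  shadow-truncate : ∀ {u v l} → u ⊑ l → (∀ c → u ⊑ c → v ⊑ c → l ⊑ c) → Shadow T u l u v
  shadow-truncate u⊑l l-below c (c≢r , inj₁ (u⊑c , l⋢c)) =
    c≢r , inj₁ (u⊑c , λ v⊑c → l⋢c (l-below c u⊑c v⊑c))
  shadow-truncate u⊑l l-below c (c≢r , inj₂ (u⋢c , l⊑c)) = ⊥-elim (u⋢c (⊑-trans u⊑l l⊑c))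

  opaque
    leaf? : ∀ v → Dec (Leaf T v)
    leaf? v = ¬? (v ≟ root T) ×-dec all? (λ w → ¬? (parent T w ≟ v))

    nodeOnPath? : ∀ a b w → Dec (NodeOnPath T a b w)
    nodeOnPath? a b w = (a ⊑? w ⊎-dec b ⊑? w) ×-dec all? (λ z → a ⊑? z →-dec b ⊑? z →-dec w ⊑? z)

    twinLink? : ∀ a b → Dec (TwinLink T a b)
    twinLink? a b = leaf? a ×-dec leaf? b ×-dec ¬? (a ≟ b) ×-dec ¬? (nodeOnPath? a b (root T)) ×-dec
                    all? (λ w → nodeOnPath? a b (parent T w) →-dec nodeOnPath? a b w)

    isLCA? : ∀ u v l → Dec (IsLCA T u v l)
    isLCA? u v l = u ⊑? l ×-dec v ⊑? l ×-dec all? (λ z → u ⊑? z →-dec v ⊑? z →-dec l ⊑? z)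

  NodeOnPath-sym : ∀ {a b w} → NodeOnPath T a b w → NodeOnPath T b a w
  NodeOnPath-sym (a⊑w⊎b⊑w , least) = Data.Sum.swap a⊑w⊎b⊑w , λ z b⊑z a⊑z → least z a⊑z b⊑z

  twinLink-sym : ∀ {a b} → TwinLink T a b → TwinLink T b a
  twinLink-sym (leaf-a , leaf-b , a≢b , r∉P , closed) =
    leaf-b , leaf-a , a≢b ∘ sym , r∉P ∘ NodeOnPath-sym , λ w → NodeOnPath-sym ∘ closed w ∘ NodeOnPath-sym

  stem-subtree-on-path : ∀ {a b l w} → TwinLink T a b → IsLCA T a b l → w ⊑ l → NodeOnPath T a b w
  stem-subtree-on-path {a} {b} {l} (_ , _ , _ , _ , closed) (a⊑l , _ , least) (k , wₖ≡l) = go k _ wₖ≡l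
    where
    go : ∀ k w → ↑ k w ≡ l → NodeOnPath T a b w
    go zero w w≡l = subst (NodeOnPath T a b) (sym w≡l) (inj₁ a⊑l , least)
    go (suc k) w wₖ₊₁≡l = closed w (go k (parent T w) (trans (sym (iter-suc (parent T) k w)) wₖ₊₁≡l))

  twins-below-stem : ∀ {a b l w} → TwinLink T a b → IsLCA T a b l → Leaf T w → w ⊑ l → w ≡ a ⊎ w ≡ b
  twins-below-stem twin lca leaf-w w⊑l with stem-subtree-on-path twin lca w⊑l
  ... | inj₁ a⊑w , _ = inj₁ (sym (⊑-leaf leaf-w a⊑w))
  ... | inj₂ b⊑w , _ = inj₂ (sym (⊑-leaf leaf-w b⊑w))

  twin-unique : ∀ {a b b′} → TwinLink T a b → TwinLink T a b′ → b ≡ b′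
  twin-unique {a} {b} {b′} twin twin′ with lca-exists a b | lca-exists a b′
  ... | l , lca@(a⊑l , b⊑l , _) | l′ , lca′@(a⊑l′ , b′⊑l′ , _) with ancestors-comparable a⊑l a⊑l′
  ... | inj₁ l⊑l′ = Data.Sum.[ (λ b≡a → ⊥-elim (proj₁ (proj₂ (proj₂ twin)) (sym b≡a))) , id ]
                      (twins-below-stem twin′ lca′ (proj₁ (proj₂ twin)) (⊑-trans b⊑l l⊑l′))
  ... | inj₂ l′⊑l = Data.Sum.[ (λ b′≡a → ⊥-elim (proj₁ (proj₂ (proj₂ twin′)) (sym b′≡a))) , sym ]
                      (twins-below-stem twin lca (proj₁ (proj₂ twin′)) (⊑-trans b′⊑l′ l′⊑l))

  strictly-below-stem-on-path : ∀ {a b l c} → TwinLink T a b → IsLCA T a b l → c ⊑ l → ¬ l ⊑ c →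
                                (a ⊑ c × ¬ b ⊑ c) ⊎ (¬ a ⊑ c × b ⊑ c)
  strictly-below-stem-on-path twin lca@(_ , _ , least) c⊑l l⋢c with stem-subtree-on-path twin lca c⊑l
  ... | inj₁ a⊑c , _ = inj₁ (a⊑c , λ b⊑c → l⋢c (least _ a⊑c b⊑c))
  ... | inj₂ b⊑c , _ = inj₂ ((λ a⊑c → l⋢c (least _ a⊑c b⊑c)) , b⊑c)

  SamePair-twinLink : ∀ {x p y q} → SamePair y q x p → TwinLink T x p → TwinLink T y q
  SamePair-twinLink (inj₁ (refl , refl)) twin = twin
  SamePair-twinLink (inj₂ (refl , refl)) twin = twinLink-sym twin

  lca-not-leaf : ∀ {a b l} → a ≢ b → IsLCA T a b l → ¬ Leaf T l
  lca-not-leaf a≢b (a⊑l , b⊑l , _) leaf-l = a≢b (trans (⊑-leaf leaf-l a⊑l) (sym (⊑-leaf leaf-l b⊑l)))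

  stem≢root : ∀ {a b l} → TwinLink T a b → IsLCA T a b l → l ≢ root T
  stem≢root (_ , _ , _ , root∉path , _) (a⊑l , _ , least) l≡r =
    root∉path (subst (NodeOnPath T _ _) l≡r (inj₁ a⊑l , least))

  -- Otherwise a (parent v) is a shadow of az, hence a link of E, whose endpoint parent v is closer to
  -- the root than the up-node of a, which lies in T_v.
  neighbour-⊑-closed-subtree : ∀ {E a v z} → ClosedUnderShadows T E → v ≢ root T → Closed T E a v →
                               E a z ≡ true → z ⊑ v
  neighbour-⊑-closed-subtree {E} {a} {v} {z} E-closed v≢r (a⊑v , u , (_ , up-min) , u⊑v) Eaz with z ⊑? v
  ... | yes z⊑v = z⊑v
  ... | no z⋢v with depth-exists u | depth-exists (parent T v)
  ... | k , depth-u | k′ , depth-pv =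
    ⊥-elim (<⇒≱ (depth-parent< u⊑v v≢r depth-u depth-pv) (up-min (parent T v) Ea-pv k k′ depth-u depth-pv))
    where
    a≢pv : a ≢ parent T v
    a≢pv a≡pv = parent-⋢ v≢r (subst (_⊑ v) a≡pv a⊑v)
    pv-below : ∀ c → a ⊑ c → z ⊑ c → parent T v ⊑ c
    pv-below c a⊑c z⊑c =
      parent-⊑ (ancestor-above a⊑v z⋢v a⊑c z⊑c) (λ v≡c → z⋢v (subst (z ⊑_) (sym v≡c) z⊑c))
    Ea-pv : E a (parent T v) ≡ true
    Ea-pv = E-closed a z a (parent T v) Eaz a≢pv (shadow-truncate (⊑-trans a⊑v (⊑-parent v)) pv-below)

module _ {n : ℕ} where

  ≟-both : ∀ {x u y v : Fin n} → (⌊ x ≟ u ⌋ ∧ ⌊ y ≟ v ⌋) ≡ true → x ≡ u × y ≡ v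
  ≟-both {x} {u} {y} {v} eq with x ≟ u | y ≟ v
  ... | yes x≡u | yes y≡v = x≡u , y≡v

  pairEqᵇ-sound : ∀ {x y u v : Fin n} → pairEqᵇ x y u v ≡ true → SamePair x y u v
  pairEqᵇ-sound {x} {y} {u} {v} eq with ⌊ x ≟ u ⌋ ∧ ⌊ y ≟ v ⌋ in direct
  ... | true = inj₁ (≟-both direct)
  ... | false = inj₂ (≟-both eq)

  pairEqᵇ-refl : ∀ (u v : Fin n) → pairEqᵇ u v u v ≡ true
  pairEqᵇ-refl u v with u ≟ u | v ≟ v
  ... | yes _ | yes _ = refl
  ... | no u≢u | _ = ⊥-elim (u≢u refl)
  ... | yes _ | no v≢v = ⊥-elim (v≢v refl)

  removeLink-keeps : ∀ {F : LinkSet n} {u v x y} → F x y ≡ true → ¬ SamePair x y u v → removeLink F u v x y ≡ true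
  removeLink-keeps {x = x} {y} Fxy other rewrite Fxy | ¬-not (other ∘ pairEqᵇ-sound {x} {y}) = refl

  replaceLink-keeps : ∀ {F : LinkSet n} {u v u′ v′ x y} → F x y ≡ true → ¬ SamePair x y u v →
                      replaceLink F u v u′ v′ x y ≡ true
  replaceLink-keeps {F} {u} {v} {x = x} {y} Fxy other rewrite removeLink-keeps {F} {u} {v} {x} {y} Fxy other = refl

  replaceLink-adds : ∀ {F : LinkSet n} {u v u′ v′} → replaceLink F u v u′ v′ u′ v′ ≡ true
  replaceLink-adds {F} {u} {v} {u′} {v′} rewrite pairEqᵇ-refl u′ v′ = ∨-zeroʳ _

  samePair? : ∀ (x y u v : Fin n) → Dec (SamePair x y u v)
  samePair? x y u v = ((x ≟ u) ×-dec (y ≟ v)) ⊎-dec ((x ≟ v) ×-dec (y ≟ u))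

  private
    cover-after-edit : ∀ {T : RootedTree n} {F u v} → IsCover T F → (G : LinkSet n) →
      (∀ {x y} → F x y ≡ true → ¬ SamePair x y u v → G x y ≡ true) →
      (∀ c → OnPath T u v c → ∃[ x ] ∃[ y ] (G x y ≡ true × OnPath T x y c)) → IsCover T G
    cover-after-edit {T} {F} {u} {v} F-cover G keeps repair c c≢r with F-cover c c≢r
    ... | x , y , Fxy , onPath with samePair? x y u v
    ...   | yes same = repair c (TreeOrder.SamePair-OnPath T same onPath)
    ...   | no other = x , y , keeps Fxy other , onPath

  CoveredByOther : RootedTree n → LinkSet n → Fin n → Fin n → Fin n → Set
  CoveredByOther T F u v c = ∃[ x ] ∃[ y ] (F x y ≡ true × ¬ SamePair x y u v × OnPath T x y c)

  cover-after-removal : ∀ {T : RootedTree n} {F u v} → IsCover T F →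
    (∀ c → OnPath T u v c → CoveredByOther T F u v c) → IsCover T (removeLink F u v)
  cover-after-removal {T} {F} {u} {v} F-cover other =
    cover-after-edit {T} {F} {u} {v} F-cover (removeLink F u v) (removeLink-keeps {F = F}) repair
    where
    repair : ∀ c → OnPath T u v c → ∃[ x ] ∃[ y ] (removeLink F u v x y ≡ true × OnPath T x y c)
    repair c onPath with other c onPath
    ... | x , y , Fxy , different , onPath′ = x , y , removeLink-keeps {F = F} Fxy different , onPath′

  cover-after-replacement : ∀ {T : RootedTree n} {F u v u′ v′} → IsCover T F →
    (∀ c → OnPath T u v c → OnPath T u′ v′ c ⊎ CoveredByOther T F u v c) → IsCover T (replaceLink F u v u′ v′)
  cover-after-replacement {T} {F} {u} {v} {u′} {v′} F-cover new-or-other =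
    cover-after-edit {T} {F} {u} {v} F-cover (replaceLink F u v u′ v′) (replaceLink-keeps {F = F}) repair
    where
    repair : ∀ c → OnPath T u v c → ∃[ x ] ∃[ y ] (replaceLink F u v u′ v′ x y ≡ true × OnPath T x y c)
    repair c onPath with new-or-other c onPath
    ... | inj₁ onPath′ = u′ , v′ , replaceLink-adds {F = F} {u} {v} , onPath′
    ... | inj₂ (x , y , Fxy , different , onPath′) = x , y , replaceLink-keeps {F = F} Fxy different , onPath′

module ShadowsMinimal {n : ℕ} {T : RootedTree n} {E F : LinkSet n} (F-smc : ShadowsMinimalCover T E F) where

  open TreeOrder T

  F-linkSet : IsLinkSet F
  F-linkSet = proj₁ (proj₁ (proj₁ F-smc))

  F⊆E : F ⊆L E
  F⊆E = proj₁ (proj₂ (proj₁ (proj₁ F-smc)))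

  F-cover : IsCover T F
  F-cover = proj₂ (proj₂ (proj₁ (proj₁ F-smc)))

  private
    inclusion-minimal : ∀ u v → F u v ≡ true → ¬ IsCover T (removeLink F u v)
    inclusion-minimal = proj₂ (proj₁ F-smc)

    shadows-minimal : ∀ u v u′ v′ → F u v ≡ true → ProperShadow T u′ v′ u v →
                      ¬ IsCover T (replaceLink F u v u′ v′)
    shadows-minimal = proj₂ F-smc

  F-sym : ∀ {u v} → F u v ≡ true → F v u ≡ true
  F-sym {u} {v} Fuv = trans (proj₁ F-linkSet v u) Fuv

  F-irrefl : ∀ {u v} → F u v ≡ true → u ≢ v
  F-irrefl {u} Fuu refl with trans (sym Fuu) (proj₂ F-linkSet u)
  ... | ()

  leaf-partner : ∀ {a} → Leaf T a → ∃[ p ] F a p ≡ true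
  leaf-partner {a} leaf-a with F-cover a (proj₁ leaf-a)
  ... | u , v , Fuv , _ , inj₁ (u⊑a , _) = v , subst (λ w → F w v ≡ true) (⊑-leaf leaf-a u⊑a) Fuv
  ... | u , v , Fuv , _ , inj₂ (_ , v⊑a) = u , F-sym (subst (λ w → F u w ≡ true) (⊑-leaf leaf-a v⊑a) Fuv)

  leaf-edge-on-path : ∀ {a z} → Leaf T a → F a z ≡ true → OnPath T a z a
  leaf-edge-on-path leaf-a Faz = proj₁ leaf-a , inj₁ (⊑-refl , λ z⊑a → F-irrefl Faz (sym (⊑-leaf leaf-a z⊑a)))

  private
    other-link : ∀ {a y z} → F a z ≡ true → y ≢ z → ¬ SamePair a z a y
    other-link Faz y≢z (inj₁ (_ , z≡y)) = y≢z (sym z≡y)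
    other-link Faz y≢z (inj₂ (_ , z≡a)) = F-irrefl Faz (sym z≡a)

  -- A second link az at the leaf a covers the edge above a, so ay could be dropped (if y is the parent
  -- of a) or shortened to (parent a) y.
  leaf-partner-unique : ∀ {a y z} → Leaf T a → F a y ≡ true → F a z ≡ true → y ≡ z
  leaf-partner-unique {a} {y} {z} leaf-a Fay Faz with y ≟ z
  ... | yes y≡z = y≡z
  ... | no y≢z with y ≟ parent T a
  ...   | yes refl = ⊥-elim (inclusion-minimal a y Fay (cover-after-removal {T = T} F-cover repair))
    where
    repair : ∀ c → OnPath T a y c → CoveredByOther T F a y c
    repair c onPath with OnPath-parent onPath
    ... | inj₁ refl = a , z , Faz , other-link Faz y≢z , leaf-edge-on-path leaf-a Faz
    ... | inj₂ loop = ⊥-elim (¬OnPath-loop loop)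
  ...   | no y≢pa = ⊥-elim (shadows-minimal a y (parent T a) y Fay proper
                      (cover-after-replacement {T = T} F-cover repair))
    where
    pa-below : ∀ c → a ⊑ c → y ⊑ c → parent T a ⊑ c
    pa-below c a⊑c y⊑c = parent-⊑ a⊑c (λ a≡c → F-irrefl Fay (sym (⊑-leaf leaf-a (subst (y ⊑_) (sym a≡c) y⊑c))))
    proper : ProperShadow T (parent T a) y a y
    proper = y≢pa ∘ sym , shadow-lift (⊑-parent a) pa-below ,
             λ { (inj₁ (pa≡a , _)) → proj₂ leaf-a a pa≡a ; (inj₂ (pa≡y , _)) → y≢pa (sym pa≡y) }
    repair : ∀ c → OnPath T a y c → OnPath T (parent T a) y c ⊎ CoveredByOther T F a y c
    repair c onPath with OnPath-parent onPath
    ... | inj₁ refl = inj₂ (a , z , Faz , other-link Faz y≢z , leaf-edge-on-path leaf-a Faz)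
    ... | inj₂ lifted = inj₁ lifted

  degree-leaf : ∀ {a} → Leaf T a → degree F a ≡ 1
  degree-leaf leaf-a with leaf-partner leaf-a
  ... | p , Fap = card-≡1 Fap (λ y Fay → leaf-partner-unique leaf-a Fay Fap)

  innerDegree : Fin n → ℕ
  innerDegree z = if does (leaf? z) then 0 else degree F z

  2*size≡leaves+innerDegrees : 2 * size F ≡ card (does ∘ leaf?) + ∑[ z < n ] innerDegree z
  2*size≡leaves+innerDegrees = begin
    2 * size F
      ≡⟨ handshake F F-linkSet ⟩
    ∑[ z < n ] degree F z
      ≡⟨ sum-cong-≗ leaf-or-inner ⟩
    ∑[ z < n ] (indicator (does (leaf? z)) + innerDegree z)
      ≡⟨ ∑-distrib-+ (indicator ∘ does ∘ leaf?) innerDegree ⟩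
    ∑[ z < n ] indicator (does (leaf? z)) + ∑[ z < n ] innerDegree z
      ≡⟨ cong (_+ ∑[ z < n ] innerDegree z) (card≡∑ (does ∘ leaf?)) ⟨
    card (does ∘ leaf?) + ∑[ z < n ] innerDegree z ∎
    where
    open ≡-Reasoning
    leaf-or-inner : ∀ z → degree F z ≡ indicator (does (leaf? z)) + innerDegree z
    leaf-or-inner z with leaf? z
    ... | yes leaf-z = degree-leaf leaf-z
    ... | no _ = refl

  leaf-link-unique : ∀ {x p y q} → Leaf T x → Leaf T p → F x p ≡ true → y ≡ x ⊎ y ≡ p → F y q ≡ true →
                     SamePair y q x p
  leaf-link-unique leaf-x _ Fxp (inj₁ refl) Fyq = inj₁ (refl , leaf-partner-unique leaf-x Fyq Fxp)
  leaf-link-unique _ leaf-p Fxp (inj₂ refl) Fyq = inj₂ (refl , leaf-partner-unique leaf-p Fyq (F-sym Fxp))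

  private
    -- A link uv leaving T_l from an inner node u ≠ l could be shortened to lv: the edges between u and
    -- l lie on the twin link, because T_l is the path of the twin link.
    link-leaving-stem : ∀ {x p l u v} → TwinLink T x p → F x p ≡ true → IsLCA T x p l →
                        F u v ≡ true → u ⊑ l → ¬ v ⊑ l → ∃[ w ] F l w ≡ true
    link-leaving-stem {x} {p} {l} {u} {v} twin Fxp lca Fuv u⊑l v⋢l with u ≟ l | leaf? u
    ... | yes refl | _ = v , Fuv
    ... | no _ | yes leaf-u = ⊥-elim (v⋢l v⊑l)
      where
      v⊑l : v ⊑ l
      v⊑l with leaf-link-unique (proj₁ twin) (proj₁ (proj₂ twin)) Fxp (twins-below-stem twin lca leaf-u u⊑l) Fuv
      ... | inj₁ (_ , refl) = proj₁ (proj₂ lca)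
      ... | inj₂ (_ , refl) = proj₁ lca
    ... | no u≢l | no inner-u =
      ⊥-elim (shadows-minimal u v l v Fuv proper (cover-after-replacement {T = T} F-cover repair))
      where
      l≢v : l ≢ v
      l≢v l≡v = v⋢l (subst (_⊑ l) l≡v ⊑-refl)
      proper : ProperShadow T l v u v
      proper = l≢v , shadow-lift u⊑l (λ c → ancestor-above u⊑l v⋢l) ,
               λ { (inj₁ (l≡u , _)) → u≢l (sym l≡u) ; (inj₂ (l≡v , _)) → l≢v l≡v }
      xp-other : ¬ SamePair x p u v
      xp-other (inj₁ (x≡u , _)) = inner-u (subst (Leaf T) x≡u (proj₁ twin))
      xp-other (inj₂ (_ , p≡u)) = inner-u (subst (Leaf T) p≡u (proj₁ (proj₂ twin)))
      repair : ∀ c → OnPath T u v c → OnPath T l v c ⊎ CoveredByOther T F u v c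
      repair c (c≢r , inj₂ (u⋢c , v⊑c)) = inj₁ (c≢r , inj₂ (u⋢c ∘ ⊑-trans u⊑l , v⊑c))
      repair c (c≢r , inj₁ (u⊑c , v⋢c)) with l ⊑? c | ancestors-comparable u⊑c u⊑l
      ... | yes l⊑c | _ = inj₁ (c≢r , inj₁ (l⊑c , v⋢c))
      ... | no l⋢c | inj₁ c⊑l = inj₂ (x , p , Fxp , xp-other , c≢r , strictly-below-stem-on-path twin lca c⊑l l⋢c)
      ... | no l⋢c | inj₂ l⊑c = ⊥-elim (l⋢c l⊑c)

  stem-incident : ∀ {x p l} → TwinLink T x p → F x p ≡ true → IsLCA T x p l → ∃[ w ] F l w ≡ true
  stem-incident {l = l} twin Fxp lca with F-cover l (stem≢root twin lca)
  ... | u , v , Fuv , _ , inj₁ (u⊑l , v⋢l) = link-leaving-stem twin Fxp lca Fuv u⊑l v⋢l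
  ... | u , v , Fuv , _ , inj₂ (u⋢l , v⊑l) = link-leaving-stem twin Fxp lca (F-sym Fuv) v⊑l u⋢l

module Charging {n : ℕ} (T : RootedTree n) (E F : LinkSet n) (E-closed : ClosedUnderShadows T E)
  (F-smc : ShadowsMinimalCover T E F)
  (J : LinkSet n) (J-spec : ∀ x y → (J x y ≡ true) ⇔ (F x y ≡ true × ¬ Locked T E x × ¬ Locked T E y)) where

  open TreeOrder T
  open ShadowsMinimal {T = T} {E} {F} F-smc

  StemOfLinkAt : Fin n → Fin n → Set
  StemOfLinkAt z x = ∃[ p ] (F x p ≡ true × TwinLink T x p × IsLCA T x p z)

  -- For an inner node z this says that a is locked (locked-of-lockedNeighbour); stating it through J
  -- keeps it decidable.
  LockedNeighbour : Fin n → Fin n → Set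
  LockedNeighbour z a = F z a ≡ true × J z a ≡ false

  NonTwinLinkNearTwinOf : Fin n → Fin n → Set
  NonTwinLinkNearTwinOf a x = ∃[ p ] (F x p ≡ true × ¬ TwinLink T x p × (TwinLink T a x ⊎ TwinLink T a p))

  ViaLockedNeighbour : Fin n → Fin n → Set
  ViaLockedNeighbour z x = ∃[ a ] (LockedNeighbour z a × NonTwinLinkNearTwinOf a x)

  Charged : Fin n → Fin n → Set
  Charged x z = ¬ Leaf T z × (F z x ≡ true ⊎ StemOfLinkAt z x ⊎ ViaLockedNeighbour z x)

  opaque
    stemOfLinkAt? : ∀ z x → Dec (StemOfLinkAt z x)
    stemOfLinkAt? z x = any? (λ p → (F x p Bool.≟ true) ×-dec twinLink? x p ×-dec isLCA? x p z)

  lockedNeighbour? : ∀ z a → Dec (LockedNeighbour z a)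
  lockedNeighbour? z a = (F z a Bool.≟ true) ×-dec (J z a Bool.≟ false)

  opaque
    nonTwinLinkNearTwinOf? : ∀ a x → Dec (NonTwinLinkNearTwinOf a x)
    nonTwinLinkNearTwinOf? a x =
      any? (λ p → (F x p Bool.≟ true) ×-dec ¬? (twinLink? x p) ×-dec (twinLink? a x ⊎-dec twinLink? a p))

  viaLockedNeighbour? : ∀ z x → Dec (ViaLockedNeighbour z x)
  viaLockedNeighbour? z x = any? (λ a → lockedNeighbour? z a ×-dec nonTwinLinkNearTwinOf? a x)

  opaque
    charged? : ∀ x z → Dec (Charged x z)
    charged? x z = ¬? (leaf? z) ×-dec ((F z x Bool.≟ true) ⊎-dec stemOfLinkAt? z x ⊎-dec viaLockedNeighbour? z x)

  charge : Fin n → ℕ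
  charge z = card (λ x → does (charged? x z))

  lockedNeighbour-of-locked : ∀ {a b b′} → LockedBy T E a b b′ → F b b′ ≡ true →
                              ∃[ z ] (¬ Leaf T z × LockedNeighbour z a)
  lockedNeighbour-of-locked {a} {b} {b′} locked@(a≢b′ , _ , v , v≢r , leaves , twin , closed) Fbb′
    with leaf-partner (proj₁ twin)
  ... | z , Faz = z , inner-z , F-sym Faz , Jza≡false
    where
    z⊑v : z ⊑ v
    z⊑v = neighbour-⊑-closed-subtree E-closed v≢r closed (F⊆E a z Faz)
    inner-z : ¬ Leaf T z
    inner-z leaf-z with to (leaves z) (z⊑v , leaf-z)
    ... | inj₁ z≡a = F-irrefl Faz (sym z≡a)
    ... | inj₂ (inj₁ refl) = a≢b′ (leaf-partner-unique leaf-z (F-sym Faz) Fbb′)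
    ... | inj₂ (inj₂ refl) = proj₁ (proj₂ (proj₂ twin)) (leaf-partner-unique leaf-z (F-sym Faz) (F-sym Fbb′))
    Jza≡false : J z a ≡ false
    Jza≡false = ¬-not (λ Jza → proj₂ (proj₂ (to (J-spec z a) Jza)) (proj₁ twin , b , b′ , locked))

  locked-of-lockedNeighbour : ∀ {z a} → ¬ Leaf T z → LockedNeighbour z a → ¬ ¬ Locked T E a
  locked-of-lockedNeighbour {z} {a} inner-z (Fza , Jza≡false) unlocked-a
    with trans (sym Jza≡false) (from (J-spec z a) (Fza , inner-z ∘ proj₁ , unlocked-a))
  ... | ()

  private
    the-other-two : ∀ {a y y′ s t : Fin n} → s ≡ a ⊎ s ≡ y ⊎ s ≡ y′ → t ≡ a ⊎ t ≡ y ⊎ t ≡ y′ →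
                    s ≢ a → t ≢ a → s ≢ t → y ≡ s ⊎ y ≡ t
    the-other-two (inj₁ s≡a) _ s≢a _ _ = ⊥-elim (s≢a s≡a)
    the-other-two _ (inj₁ t≡a) _ t≢a _ = ⊥-elim (t≢a t≡a)
    the-other-two (inj₂ (inj₁ s≡y)) _ _ _ _ = inj₁ (sym s≡y)
    the-other-two (inj₂ (inj₂ _)) (inj₂ (inj₁ t≡y)) _ _ _ = inj₂ (sym t≡y)
    the-other-two (inj₂ (inj₂ s≡y′)) (inj₂ (inj₂ t≡y′)) _ _ s≢t = ⊥-elim (s≢t (trans s≡y′ (sym t≡y′)))

  -- The locked leaf a has its partner z and its twin y in a subtree with leaves a, y, y′.  So the
  -- twins x₁, p₁ below the stem z are y and y′, and the link x₂p₂ through y is the twin link yy′.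
  stem-excludes-lock : ∀ {z x₁ x₂} → ¬ Leaf T z → StemOfLinkAt z x₁ → ¬ ViaLockedNeighbour z x₂
  stem-excludes-lock {z} {x₁} {x₂} inner-z (p₁ , Fx₁p₁ , twin₁ , lca₁)
                     (a , nbr@(Fza , _) , p₂ , Fx₂p₂ , not-twin₂ , near) =
    locked-of-lockedNeighbour inner-z nbr not-locked
    where
    leaf-x₁ : Leaf T x₁
    leaf-x₁ = proj₁ twin₁
    leaf-p₁ : Leaf T p₁
    leaf-p₁ = proj₁ (proj₂ twin₁)
    not-partner-of : ∀ {s t} → Leaf T a → Leaf T t → F s t ≡ true → s ≢ a
    not-partner-of leaf-a leaf-t Fat refl = inner-z (subst (Leaf T) (leaf-partner-unique leaf-a Fat (F-sym Fza)) leaf-t)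
    link-through : ∀ {y} → TwinLink T a y → y ≡ x₁ ⊎ y ≡ p₁ → TwinLink T a x₂ ⊎ TwinLink T a p₂ →
                   TwinLink T x₂ p₂
    link-through twin-ay y∈ (inj₁ twin-ax₂) rewrite twin-unique twin-ay twin-ax₂ =
      SamePair-twinLink (leaf-link-unique leaf-x₁ leaf-p₁ Fx₁p₁ y∈ Fx₂p₂) twin₁
    link-through twin-ay y∈ (inj₂ twin-ap₂) rewrite twin-unique twin-ay twin-ap₂ =
      twinLink-sym (SamePair-twinLink (leaf-link-unique leaf-x₁ leaf-p₁ Fx₁p₁ y∈ (F-sym Fx₂p₂)) twin₁)
    not-locked : ¬ Locked T E a
    not-locked (leaf-a , y , y′ , _ , _ , v , v≢r , leaves , twin-ay , closed) =
      not-twin₂ (link-through twin-ay y∈x₁p₁ near)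
      where
      z⊑v : z ⊑ v
      z⊑v = neighbour-⊑-closed-subtree E-closed v≢r closed (F⊆E a z (F-sym Fza))
      leaf-below-z : ∀ {w} → w ⊑ z → Leaf T w → w ≡ a ⊎ w ≡ y ⊎ w ≡ y′
      leaf-below-z w⊑z leaf-w = to (leaves _) (⊑-trans w⊑z z⊑v , leaf-w)
      y∈x₁p₁ : y ≡ x₁ ⊎ y ≡ p₁
      y∈x₁p₁ = the-other-two (leaf-below-z (proj₁ lca₁) leaf-x₁) (leaf-below-z (proj₁ (proj₂ lca₁)) leaf-p₁)
                             (not-partner-of leaf-a leaf-p₁ Fx₁p₁) (not-partner-of leaf-a leaf-x₁ (F-sym Fx₁p₁))
                             (proj₁ (proj₂ (proj₂ twin₁)))

  leaf-charged : ∀ {x p} → Leaf T x → F x p ≡ true → (Leaf T p → ¬ ¬ InW T E x p) → ∃[ z ] Charged x z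
  leaf-charged {x} {p} leaf-x Fxp in-W with leaf? p
  ... | no inner-p = p , inner-p , inj₁ (F-sym Fxp)
  ... | yes leaf-p with twinLink? x p
  ...   | yes twin = let (l , lca) = lca-exists x p in
                     l , lca-not-leaf (proj₁ (proj₂ (proj₂ twin))) lca , inj₂ (inj₁ (p , Fxp , twin , lca))
  ...   | no not-twin with any? (charged? x)
  ...     | yes charged = charged
  ...     | no uncharged = ⊥-elim (in-W leaf-p λ { (_ , inj₁ twin) → not-twin twin
                                                  ; (_ , inj₂ (a , locking)) → uncharged (via-lock a locking) })
    where
    via-lock : ∀ a → LockedBy T E a x p ⊎ LockedBy T E a p x → ∃[ z ] Charged x z
    via-lock a (inj₁ locked@(_ , _ , _ , _ , _ , twin-ax , _)) with lockedNeighbour-of-locked locked Fxp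
    ... | z , inner-z , nbr = z , inner-z , inj₂ (inj₂ (a , nbr , p , Fxp , not-twin , inj₁ twin-ax))
    via-lock a (inj₂ locked@(_ , _ , _ , _ , _ , twin-ap , _)) with lockedNeighbour-of-locked locked (F-sym Fxp)
    ... | z , inner-z , nbr = z , inner-z , inj₂ (inj₂ (a , nbr , p , Fxp , not-twin , inj₂ twin-ap))

  charge-leaf : ∀ {z} → Leaf T z → charge z ≡ 0
  charge-leaf {z} leaf-z = card-zero (λ x → dec-false (charged? x z) (λ (inner-z , _) → inner-z leaf-z))

  charge≤ : ∀ z → charge z ≤ degree F z + (card (does ∘ stemOfLinkAt? z) + card (does ∘ viaLockedNeighbour? z))
  charge≤ z = begin
    charge z
      ≤⟨ card-mono (λ x charged → by-kind (does-true (charged? x z) charged)) ⟩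
    card (λ x → F z x ∨ (does (stemOfLinkAt? z x) ∨ does (viaLockedNeighbour? z x)))
      ≤⟨ card-∨ (F z) (λ x → does (stemOfLinkAt? z x) ∨ does (viaLockedNeighbour? z x)) ⟩
    degree F z + card (λ x → does (stemOfLinkAt? z x) ∨ does (viaLockedNeighbour? z x))
      ≤⟨ +-monoʳ-≤ (degree F z) (card-∨ (does ∘ stemOfLinkAt? z) (does ∘ viaLockedNeighbour? z)) ⟩
    degree F z + (card (does ∘ stemOfLinkAt? z) + card (does ∘ viaLockedNeighbour? z)) ∎
    where
    open ≤-Reasoning
    by-kind : ∀ {x} → Charged x z → (F z x ∨ (does (stemOfLinkAt? z x) ∨ does (viaLockedNeighbour? z x))) ≡ true
    by-kind (_ , inj₁ Fzx) rewrite Fzx = refl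
    by-kind {x} (_ , inj₂ (inj₁ stem)) rewrite dec-true (stemOfLinkAt? z x) stem = ∨-zeroʳ (F z x)
    by-kind {x} (_ , inj₂ (inj₂ via)) rewrite dec-true (viaLockedNeighbour? z x) via | ∨-zeroʳ (does (stemOfLinkAt? z x)) =
      ∨-zeroʳ (F z x)

  stem-charges≤2 : ∀ {z x₁} → StemOfLinkAt z x₁ → card (does ∘ stemOfLinkAt? z) ≤ 2
  stem-charges≤2 {z} {x₁} (p₁ , _ , twin₁ , lca₁) = card-≤2 x₁ p₁ below-stem
    where
    below-stem : ∀ x → does (stemOfLinkAt? z x) ≡ true → x ≡ x₁ ⊎ x ≡ p₁
    below-stem x stem with does-true (stemOfLinkAt? z x) stem
    ... | _ , _ , twin , lca = twins-below-stem twin₁ lca₁ (proj₁ twin) (proj₁ lca)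

  near-twin≤2 : ∀ a → card (does ∘ nonTwinLinkNearTwinOf? a) ≤ 2
  near-twin≤2 a with any? (twinLink? a)
  ... | no no-twin = ≤-trans (≤-reflexive (card-zero none)) z≤n
    where
    none : ∀ x → does (nonTwinLinkNearTwinOf? a x) ≡ false
    none x = dec-false (nonTwinLinkNearTwinOf? a x) λ where
      (_ , _ , _ , inj₁ twin-ax) → no-twin (x , twin-ax)
      (p , _ , _ , inj₂ twin-ap) → no-twin (p , twin-ap)
  ... | yes (y , twin-ay) with leaf-partner (proj₁ (proj₂ twin-ay))
  ...   | q , Fyq = card-≤2 y q twin-or-partner
    where
    twin-or-partner : ∀ x → does (nonTwinLinkNearTwinOf? a x) ≡ true → x ≡ y ⊎ x ≡ q
    twin-or-partner x near with does-true (nonTwinLinkNearTwinOf? a x) near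
    ... | _ , _ , _ , inj₁ twin-ax = inj₁ (twin-unique twin-ax twin-ay)
    ... | p , Fxp , _ , inj₂ twin-ap rewrite twin-unique twin-ap twin-ay =
      inj₂ (leaf-partner-unique (proj₁ (proj₂ twin-ay)) (F-sym Fxp) Fyq)

  via-lock≤ : ∀ z → card (does ∘ viaLockedNeighbour? z) ≤ card (does ∘ lockedNeighbour? z) * 2
  via-lock≤ z = card-any×≤ (lockedNeighbour? z) nonTwinLinkNearTwinOf? 2 near-twin≤2

  degree-split : ∀ z → degree F z ≡ degree J z + card (does ∘ lockedNeighbour? z)
  degree-split z = trans (card-split (F z) (J z)) (cong₂ _+_ (card-cong J⊆F) (card-cong unjustified))
    where
    J⊆F : ∀ a → (F z a ∧ J z a) ≡ J z a
    J⊆F a with J z a in Jza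
    ... | true rewrite proj₁ (to (J-spec z a) Jza) = refl
    ... | false = ∧-zeroʳ (F z a)
    unjustified : ∀ a → (F z a ∧ not (J z a)) ≡ does (lockedNeighbour? z a)
    unjustified a with F z a | J z a
    ... | true | true = refl
    ... | true | false = refl
    ... | false | _ = refl

  private
    d+2d≡3d : ∀ d → d + 2 * d ≡ 3 * d
    d+2d≡3d = solve-∀

  charge-at-stem : ∀ {z x₁} → StemOfLinkAt z x₁ → charge z ≤ 3 * degree F z
  charge-at-stem {z} stem@(p₁ , Fx₁p₁ , twin₁ , lca₁) = begin
    charge z
      ≤⟨ charge≤ z ⟩
    degree F z + (card (does ∘ stemOfLinkAt? z) + card (does ∘ viaLockedNeighbour? z))
      ≤⟨ +-monoʳ-≤ (degree F z) (+-mono-≤ (stem-charges≤2 stem) (≤-reflexive no-lock-charges)) ⟩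
    degree F z + 2 * 1
      ≤⟨ +-monoʳ-≤ (degree F z) (*-monoʳ-≤ 2 (card-pos (F z) (proj₂ (stem-incident twin₁ Fx₁p₁ lca₁)))) ⟩
    degree F z + 2 * degree F z
      ≡⟨ d+2d≡3d (degree F z) ⟩
    3 * degree F z ∎
    where
    open ≤-Reasoning
    no-lock-charges : card (does ∘ viaLockedNeighbour? z) ≡ 0
    no-lock-charges = card-zero (λ x → dec-false (viaLockedNeighbour? z x)
                                   (stem-excludes-lock (lca-not-leaf (proj₁ (proj₂ (proj₂ twin₁))) lca₁) stem))

  charge-off-stems : ∀ {z} → (∀ x → ¬ StemOfLinkAt z x) → charge z + 2 * degree J z ≤ 3 * degree F z
  charge-off-stems {z} no-stem = begin
    charge z + 2 * degree J z
      ≤⟨ +-monoˡ-≤ (2 * degree J z) (charge≤ z) ⟩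
    degree F z + (card (does ∘ stemOfLinkAt? z) + card (does ∘ viaLockedNeighbour? z)) + 2 * degree J z
      ≤⟨ +-monoˡ-≤ (2 * degree J z)
                   (+-monoʳ-≤ (degree F z) (+-mono-≤ (≤-reflexive no-stem-charges) (via-lock≤ z))) ⟩
    degree F z + (0 + card (does ∘ lockedNeighbour? z) * 2) + 2 * degree J z
      ≡⟨ rearrange (degree F z) (degree J z) (card (does ∘ lockedNeighbour? z)) ⟩
    degree F z + 2 * (degree J z + card (does ∘ lockedNeighbour? z))
      ≡⟨ cong (λ d → degree F z + 2 * d) (degree-split z) ⟨
    degree F z + 2 * degree F z
      ≡⟨ d+2d≡3d (degree F z) ⟩
    3 * degree F z ∎
    where
    open ≤-Reasoning
    no-stem-charges : card (does ∘ stemOfLinkAt? z) ≡ 0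
    no-stem-charges = card-zero (λ x → dec-false (stemOfLinkAt? z x) (no-stem x))
    rearrange : ∀ d j k → d + (0 + k * 2) + 2 * j ≡ d + 2 * (j + k)
    rearrange = solve-∀

-- f = |F|, m = |M|, u = |U|, k = |N|, s = Σ_X d_J, m′ = |M_F|, d = |D|, ℓ = |L|, i = Σ_{z ∉ L} d_F(z)
-- and c = Σ_z charge(z).
bound-from-counts : ∀ {f m u k s m′ d ℓ i c} →
  2 * f ≡ ℓ + i → ℓ ≡ 2 * m + u → ℓ ≡ 2 * m′ + d → m′ + k ≤ m → d ≤ c → c + 2 * s ≤ 3 * i →
  3 * f ≥ 3 * m + 2 * u + k + s
bound-from-counts {f} {m} {u} {k} {s} {m′} {d} {ℓ} {i} {c} 2f≡ℓ+i ℓ≡2m+u ℓ≡2m′+d m′+k≤m d≤c c+2s≤3i =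
  *-cancelˡ-≤ 2 (begin
    2 * (3 * m + 2 * u + k + s)      ≡⟨ expand m u k s ⟩
    3 * (2 * m + u) + (u + 2 * k) + 2 * s
                                     ≡⟨ cong (λ l → 3 * l + (u + 2 * k) + 2 * s) ℓ≡2m+u ⟨
    3 * ℓ + (u + 2 * k) + 2 * s      ≤⟨ +-monoˡ-≤ (2 * s) (+-monoʳ-≤ (3 * ℓ) (≤-trans u+2k≤d d≤c)) ⟩
    3 * ℓ + c + 2 * s                ≡⟨ +-assoc (3 * ℓ) c (2 * s) ⟩
    3 * ℓ + (c + 2 * s)              ≤⟨ +-monoʳ-≤ (3 * ℓ) c+2s≤3i ⟩
    3 * ℓ + 3 * i                    ≡⟨ *-distribˡ-+ 3 ℓ i ⟨
    3 * (ℓ + i)                      ≡⟨ cong (3 *_) 2f≡ℓ+i ⟨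
    3 * (2 * f)                      ≡⟨ *-comm-2-3 f ⟩
    2 * (3 * f)                      ∎)
  where
  open ≤-Reasoning
  expand : ∀ m u k s → 2 * (3 * m + 2 * u + k + s) ≡ 3 * (2 * m + u) + (u + 2 * k) + 2 * s
  expand = solve-∀
  *-comm-2-3 : ∀ f → 3 * (2 * f) ≡ 2 * (3 * f)
  *-comm-2-3 = solve-∀
  u+2k≤d : u + 2 * k ≤ d
  u+2k≤d = +-cancelˡ-≤ (2 * m′) (u + 2 * k) d (begin
    2 * m′ + (u + 2 * k)   ≡⟨ regroup m′ u k ⟩
    2 * (m′ + k) + u       ≤⟨ +-monoˡ-≤ u (*-monoʳ-≤ 2 m′+k≤m) ⟩
    2 * m + u              ≡⟨ trans (sym ℓ≡2m+u) ℓ≡2m′+d ⟩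
    2 * m′ + d             ∎)
    where
    regroup : ∀ a b c → 2 * a + (b + 2 * c) ≡ 2 * (a + c) + b
    regroup = solve-∀

module Counts {n : ℕ} (T : RootedTree n) (E : LinkSet n) (E-linkSet : IsLinkSet E) (E-closed : ClosedUnderShadows T E)
  (F : LinkSet n) (F-smc : ShadowsMinimalCover T E F)
  (M : LinkSet n) (M-max : MaximumMatching T E M)
  (MF : LinkSet n) (MF-spec : ∀ x y → (MF x y ≡ true) ⇔ (F x y ≡ true × Leaf T x × Leaf T y × ¬ InW T E x y))
  (N : LinkSet n) (N-spec : ∀ x y → (N x y ≡ true) ⇔ (M x y ≡ true × ¬ MatchedBy MF x × ¬ MatchedBy MF y))
  (J : LinkSet n) (J-spec : ∀ x y → (J x y ≡ true) ⇔ (F x y ≡ true × ¬ Locked T E x × ¬ Locked T E y)) where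

  open TreeOrder T
  open ShadowsMinimal {T = T} {E} {F} F-smc
  open Charging T E F E-closed F-smc J J-spec

  private
    M-matching : IsMatching T E M
    M-matching = proj₁ M-max
    M-linkSet : IsLinkSet M
    M-linkSet = proj₁ M-matching
    M-links : ∀ x y → M x y ≡ true → E x y ≡ true × Leaf T x × Leaf T y × ¬ InW T E x y
    M-links = proj₁ (proj₂ M-matching)
    M-unique : ∀ x y z → M x y ≡ true → M x z ≡ true → y ≡ z
    M-unique = proj₂ (proj₂ M-matching)

    M-of-N : ∀ {x y} → N x y ≡ true → M x y ≡ true
    M-of-N {x} {y} Nxy = proj₁ (to (N-spec x y) Nxy)

  Unmatched : LinkSet n → Fin n → Set
  Unmatched G x = Leaf T x × ¬ MatchedBy G x

  unmatched? : ∀ G x → Dec (Unmatched G x)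
  unmatched? G x = leaf? x ×-dec ¬? (matched? G x)

  leaves≡2*size+unmatched : ∀ G → IsMatching T E G → card (does ∘ leaf?) ≡ 2 * size G + card (does ∘ unmatched? G)
  leaves≡2*size+unmatched G (G-linkSet , G-links , G-unique) =
    card≡2*size+unmatched G (does ∘ leaf?) G-linkSet (λ x y Gxy → dec-true (leaf? x) (proj₁ (proj₂ (G-links x y Gxy))))
                          G-unique

  leaves≡2*sizeM+cardU : (U : VertexSet n) → (∀ x → (U x ≡ true) ⇔ (Leaf T x × ¬ MatchedBy M x)) →
                   card (does ∘ leaf?) ≡ 2 * size M + card U
  leaves≡2*sizeM+cardU U U-spec = trans (leaves≡2*size+unmatched M M-matching) (cong (2 * size M +_) (card-cong U≗))
    where
    U≗ : ∀ x → does (unmatched? M x) ≡ U x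
    U≗ x = ≡true-⇔⇒≡ (mk⇔ (from (U-spec x) ∘ does-true (unmatched? M x)) (dec-true (unmatched? M x) ∘ to (U-spec x)))

  InW-sym : ∀ {x y} → InW T E x y → InW T E y x
  InW-sym {x} {y} (Exy , inj₁ twin) = trans (proj₁ E-linkSet y x) Exy , inj₁ (twinLink-sym twin)
  InW-sym {x} {y} (Exy , inj₂ (a , locks)) = trans (proj₁ E-linkSet y x) Exy , inj₂ (a , Data.Sum.swap locks)

  MF-matching : IsMatching T E MF
  MF-matching = (MF-sym , MF-irrefl) , MF-links , MF-unique
    where
    flip : ∀ x y → MF x y ≡ true → MF y x ≡ true
    flip x y MFxy with to (MF-spec x y) MFxy
    ... | Fxy , leaf-x , leaf-y , not-W = from (MF-spec y x) (F-sym Fxy , leaf-y , leaf-x , not-W ∘ InW-sym)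
    MF-sym : ∀ x y → MF x y ≡ MF y x
    MF-sym x y = ≡true-⇔⇒≡ (mk⇔ (flip x y) (flip y x))
    MF-irrefl : ∀ x → MF x x ≡ false
    MF-irrefl x = ¬-not (λ MFxx → F-irrefl (proj₁ (to (MF-spec x x) MFxx)) refl)
    MF-links : ∀ x y → MF x y ≡ true → E x y ≡ true × Leaf T x × Leaf T y × ¬ InW T E x y
    MF-links x y MFxy with to (MF-spec x y) MFxy
    ... | Fxy , rest = F⊆E x y Fxy , rest
    MF-unique : ∀ x y z → MF x y ≡ true → MF x z ≡ true → y ≡ z
    MF-unique x y z MFxy MFxz with to (MF-spec x y) MFxy | to (MF-spec x z) MFxz
    ... | Fxy , leaf-x , _ | Fxz , _ = leaf-partner-unique leaf-x Fxy Fxz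

  N-linkSet : IsLinkSet N
  N-linkSet = (λ x y → ≡true-⇔⇒≡ (mk⇔ (flip x y) (flip y x))) ,
              λ x → ¬-not (λ Nxx → true≢false (trans (sym (M-of-N Nxx)) (proj₂ M-linkSet x)))
    where
    true≢false : true ≢ false
    true≢false ()
    flip : ∀ x y → N x y ≡ true → N y x ≡ true
    flip x y Nxy with to (N-spec x y) Nxy
    ... | Mxy , free-x , free-y = from (N-spec y x) (trans (proj₁ M-linkSet y x) Mxy , free-y , free-x)

  MF∪N-matching : IsMatching T E (λ x y → MF x y ∨ N x y)
  MF∪N-matching = ((λ x y → cong₂ _∨_ (proj₁ (proj₁ MF-matching) x y) (proj₁ N-linkSet x y)) ,
                   (λ x → cong₂ _∨_ (proj₂ (proj₁ MF-matching) x) (proj₂ N-linkSet x))) ,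
                  links , unique
    where
    one-of : ∀ {x y} → (MF x y ∨ N x y) ≡ true → MF x y ≡ true ⊎ N x y ≡ true
    one-of {x} {y} MF∨N with MF x y
    ... | true = inj₁ refl
    ... | false = inj₂ MF∨N
    links : ∀ x y → (MF x y ∨ N x y) ≡ true → E x y ≡ true × Leaf T x × Leaf T y × ¬ InW T E x y
    links x y MF∨N with one-of MF∨N
    ... | inj₁ MFxy = proj₁ (proj₂ MF-matching) x y MFxy
    ... | inj₂ Nxy = M-links x y (M-of-N Nxy)
    unique : ∀ x y z → (MF x y ∨ N x y) ≡ true → (MF x z ∨ N x z) ≡ true → y ≡ z
    unique x y z MF∨Nxy MF∨Nxz with one-of MF∨Nxy | one-of MF∨Nxz
    ... | inj₁ MFxy | inj₁ MFxz = proj₂ (proj₂ MF-matching) x y z MFxy MFxz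
    ... | inj₁ MFxy | inj₂ Nxz = ⊥-elim (proj₁ (proj₂ (to (N-spec x z) Nxz)) (y , MFxy))
    ... | inj₂ Nxy | inj₁ MFxz = ⊥-elim (proj₁ (proj₂ (to (N-spec x y) Nxy)) (z , MFxz))
    ... | inj₂ Nxy | inj₂ Nxz = M-unique x y z (M-of-N Nxy) (M-of-N Nxz)

  sizeMF+sizeN≤sizeM : size MF + size N ≤ size M
  sizeMF+sizeN≤sizeM = begin
    size MF + size N               ≡⟨ size-∨ MF N MF-N-disjoint ⟨
    size (λ x y → MF x y ∨ N x y)  ≤⟨ proj₂ M-max _ MF∪N-matching ⟩
    size M                         ∎
    where
    open ≤-Reasoning
    MF-N-disjoint : ∀ x y → MF x y ≡ true → N x y ≡ true → ⊥
    MF-N-disjoint x y MFxy Nxy = proj₁ (proj₂ (to (N-spec x y) Nxy)) (y , MFxy)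

  unmatched-by-MF≤charges : card (does ∘ unmatched? MF) ≤ ∑[ z < n ] charge z
  unmatched-by-MF≤charges = ≤-trans (card-mono charged-somewhere) (card-any≤∑card charged?)
    where
    charged-somewhere : ∀ x → does (unmatched? MF x) ≡ true → does (any? (charged? x)) ≡ true
    charged-somewhere x u with does-true (unmatched? MF x) u
    ... | leaf-x , unmatched with leaf-partner leaf-x
    ...   | p , Fxp = dec-true (any? (charged? x)) (leaf-charged leaf-x Fxp λ leaf-p not-W →
                        unmatched (p , from (MF-spec x p) (Fxp , leaf-x , leaf-p , not-W)))

  module _ (X : VertexSet n) (X-spec : ∀ x → (X x ≡ true) ⇔ (¬ Leaf T x × ¬ Stem T x)) where

    J-degree-in-X : Fin n → ℕ
    J-degree-in-X z = if X z then degree J z else 0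

    outside-X : ∀ {z} → ¬ (¬ Leaf T z × ¬ Stem T z) → J-degree-in-X z ≡ 0
    outside-X {z} not-in-X = cong (λ b → if b then degree J z else 0) (¬-not (not-in-X ∘ to (X-spec z)))

    charge+J-degree≤ : ∀ z → charge z + 2 * J-degree-in-X z ≤ 3 * innerDegree z
    charge+J-degree≤ z with leaf? z
    ... | yes leaf-z =
      ≤-reflexive (cong₂ (λ c j → c + 2 * j) (charge-leaf {z} leaf-z) (outside-X (λ (inner-z , _) → inner-z leaf-z)))
    ... | no _ with any? (stemOfLinkAt? z)
    ...   | yes (x₁ , stem@(p₁ , _ , twin₁ , lca₁)) = begin
      charge z + 2 * J-degree-in-X z  ≡⟨ cong (λ j → charge z + 2 * j) (outside-X (λ (_ , not-stem) → not-stem z-stem)) ⟩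
      charge z + 0                    ≡⟨ +-identityʳ (charge z) ⟩
      charge z                        ≤⟨ charge-at-stem stem ⟩
      3 * degree F z                  ∎
      where
      open ≤-Reasoning
      z-stem : Stem T z
      z-stem = x₁ , p₁ , twin₁ , lca₁
    ...   | no no-stem = ≤-trans (+-monoʳ-≤ (charge z) (*-monoʳ-≤ 2 (J-degree-in-X≤ (X z))))
                                 (charge-off-stems (λ x stem → no-stem (x , stem)))
      where
      J-degree-in-X≤ : ∀ b → (if b then degree J z else 0) ≤ degree J z
      J-degree-in-X≤ true = ≤-refl
      J-degree-in-X≤ false = z≤n

    charges+J-degrees≤ : ∑[ z < n ] charge z + 2 * sumOver X (degree J) ≤ 3 * ∑[ z < n ] innerDegree z
    charges+J-degrees≤ = begin
      ∑[ z < n ] charge z + 2 * sumOver X (degree J)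
        ≡⟨ cong (λ t → ∑[ z < n ] charge z + 2 * t) (sumOver≡∑ X (degree J)) ⟩
      ∑[ z < n ] charge z + 2 * ∑[ z < n ] J-degree-in-X z
        ≡⟨ cong (∑[ z < n ] charge z +_) (*-distribˡ-sum 2 J-degree-in-X) ⟩
      ∑[ z < n ] charge z + ∑[ z < n ] (2 * J-degree-in-X z)
        ≡⟨ ∑-distrib-+ charge (λ z → 2 * J-degree-in-X z) ⟨
      ∑[ z < n ] (charge z + 2 * J-degree-in-X z)
        ≤⟨ ∑-mono-≤ charge+J-degree≤ ⟩
      ∑[ z < n ] (3 * innerDegree z)
        ≡⟨ *-distribˡ-sum 3 innerDegree ⟨
      3 * ∑[ z < n ] innerDegree z ∎
      where open ≤-Reasoning

lemma3p1 : ∀ {n} (T : RootedTree n) (E : LinkSet n) → IsLinkSet E → ClosedUnderShadows T E →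
    (F : LinkSet n) → ShadowsMinimalCover T E F →
    (∀ F' → CoverBy T E F' → size F ≤ size F') →
    (∀ F' k k' → ShadowsMinimalCover T E F' → size F' ≡ size F →
       HasTwinCount T F k → HasTwinCount T F' k' → k' ≤ k) →
    (M : LinkSet n) → MaximumMatching T E M →
    (U : VertexSet n) → (∀ x → (U x ≡ true) ⇔ (Leaf T x × ¬ MatchedBy M x)) →
    (MF : LinkSet n) →
    (∀ x y → (MF x y ≡ true) ⇔ (F x y ≡ true × Leaf T x × Leaf T y × ¬ InW T E x y)) →
    (N : LinkSet n) →
    (∀ x y → (N x y ≡ true) ⇔ (M x y ≡ true × ¬ MatchedBy MF x × ¬ MatchedBy MF y)) →
    (J : LinkSet n) →
    (∀ x y → (J x y ≡ true) ⇔ (F x y ≡ true × ¬ Locked T E x × ¬ Locked T E y)) →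
    (X : VertexSet n) → (∀ x → (X x ≡ true) ⇔ (¬ Leaf T x × ¬ Stem T x)) →
    3 * size F ≥ 3 * size M + 2 * card U + size N + sumOver X (degree J)
lemma3p1 T E E-linkSet E-closed F F-smc _ _ M M-max U U-spec MF MF-spec N N-spec J J-spec X X-spec =
  bound-from-counts {size F} {size M} {card U} {size N} {sumOver X (degree J)}
                    2*size≡leaves+innerDegrees
                    (leaves≡2*sizeM+cardU U U-spec)
                    (leaves≡2*size+unmatched MF MF-matching)
                    sizeMF+sizeN≤sizeM
                    unmatched-by-MF≤charges
                    (charges+J-degrees≤ X X-spec)
  where
  open ShadowsMinimal {T = T} {E} {F} F-smc
  open Counts T E E-linkSet E-closed F F-smc M M-max MF MF-spec N N-spec J J-spec
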